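{- Let $v \geq 7$ be an odd integer. If there exists a $\mathrm{TTS}(v)$ with a Hamiltonian $2$-BIG, then there exists a $\mathrm{TTS}(3v+3)$ with a Hamiltonian $2$-BIG.
   Context: A twofold triple system of order $v$, denoted $\mathrm{TTS}(v)$, is a pair $(V,\mathcal{B})$ where $V$ is a set of $v$ points and $\mathcal{B}$ is a collection of $3$-element subsets of $V$ (called blocks or triples; repeated blocks are permitted, i.e. $\mathcal{B}$ is a multiset) such that each $2$-element subset of $V$ is contained in exactly two blocks of $\mathcal{B}$, counted with multiplicity. The $2$-block-intersection graph ($2$-BIG) of $(V,\mathcal{B})$ is the graph whose vertices are the blocks in $\mathcal{B}$ (repeated blocks giving distinct vertices), where two vertices $B_1,B_2$ are adjacent if and only if $|B_1\cap B_2|=2$. A graph is Hamiltonian if it contains a Hamilton cycle (a cycle, of length at least $3$, through all vertices). -}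

module Defs where

open import Level using (Level; suc; _⊔_)
open import Data.Nat using (ℕ; _≤_; _*_; _+_)
open import Data.Fin using (Fin; zero; inject₁; fromℕ) renaming (suc to fsuc)
open import Data.Fin.Subset using (Subset; _∩_; ∣_∣)
open import Data.Fin.Subset.Properties using (_⊆?_; ∩-comm; ∩-idem)
open import Data.List using (List; length; lookup; filter)
open import Data.List.Relation.Unary.All as All using (All)
open import Data.List.Membership.Propositional.Properties using (∈-lookup)
open import Data.Product using (∃; Σ-syntax)
open import Function.Definitions using (Injective; Surjective)
open import Relation.Binary.Core using (Rel)
open import Relation.Binary.Definitions using (Symmetric; Irreflexive)
open import Relation.Nullary using (¬_)
open import Relation.Binary.PropositionalEquality using (_≡_; refl; sym; trans; cong)

Odd : ℕ → Set
Odd n = ∃ λ k → n ≡ 2 * k + 1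

-- The multiset of blocks is a list: repeated blocks are repeated entries, and
-- `filter` counts them with multiplicity.
record TTS (v : ℕ) : Set where
  field
    blocks   : List (Subset v)
    triples  : All (λ B → ∣ B ∣ ≡ 3) blocks
    balanced : ∀ (P : Subset v) → ∣ P ∣ ≡ 2 → length (filter (P ⊆?_) blocks) ≡ 2

record Graph (a ℓ : Level) : Set (suc (a ⊔ ℓ)) where
  field
    Vertex     : Set a
    Adj        : Rel Vertex ℓ
    Adj-sym    : Symmetric Adj
    Adj-irrefl : Irreflexive _≡_ Adj

module _ {a ℓ : Level} (G : Graph a ℓ) where
  open Graph G

  -- A cycle c₀ , c₁ , … , cₖ with k + 1 ≥ 3 distinct vertices.
  record Cycle : Set (a ⊔ ℓ) where
    field
      k        : ℕ
      2≤k      : 2 ≤ k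
      vertex   : Fin (ℕ.suc k) → Vertex
      distinct : Injective _≡_ _≡_ vertex
      step     : ∀ (i : Fin k) → Adj (vertex (inject₁ i)) (vertex (fsuc i))
      close    : Adj (vertex (fromℕ k)) (vertex zero)

  Hamiltonian : Set (a ⊔ ℓ)
  Hamiltonian = Σ[ C ∈ Cycle ] Surjective _≡_ _≡_ (Cycle.vertex C)

-- Vertices are positions in the list of blocks, so that repeated blocks give
-- distinct (and, sharing three points, non-adjacent) vertices.
2-BIG : ∀ {v} → TTS v → Graph Level.zero Level.zero
2-BIG {v} T = record
  { Vertex     = Fin (length blocks)
  ; Adj        = λ i j → ∣ block i ∩ block j ∣ ≡ 2
  ; Adj-sym    = λ {i} {j} p → trans (cong ∣_∣ (∩-comm (block j) (block i))) p
  ; Adj-irrefl = λ { {i} refl p → 3≢2 (trans (sym (All.lookup triples (∈-lookup i)))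
                                         (trans (cong ∣_∣ (sym (∩-idem (block i)))) p)) }
  }
  where
  open TTS T
  block : Fin (length blocks) → Subset v
  block = lookup blocks
  3≢2 : ¬ (3 ≡ 2)
  3≢2 ()

{-# OPTIONS --safe #-}

-- Write 3v + 3 = 6m with m ≥ 2; the system is built directly.  Take three levels, each a copy of
-- ℤ/2m.  The zigzag c, c + 1, c − 1, c + 2, …, c + m is a Hamiltonian path, and as c runs through
-- 0, …, m − 1 these paths decompose the complete graph on ℤ/2m; the same holds for the mirrored
-- zigzags c, c − 1, c + 1, c − 2, ….  For every level i, class c and b ∈ {0, 1}, join the edges of
-- a zigzag through c on level i to the apex c + bm of the next level.  These blocks form a "rail",
-- a path in the 2-BIG.  The pairs still missing form one octahedron {c, c + m} × {0, 1, 2} for each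
-- class c, and alternate faces of it complete the system.
--
-- On levels 1 and 2 both rails of a class use the same zigzag and form a ladder.  On level 0 one rail
-- uses the mirrored zigzag, so that its rungs alternate between two neighbouring classes.  For each
-- class, a level-0 rail, two octahedron faces and one ladder close up to a cycle, and these 2m cycles
-- cover all blocks.  They are arranged in a ring, and cutting one edge of every level-0 rail and
-- inserting the rungs of level 0 between consecutive cuts merges them into a Hamilton cycle.

module Submission where

open import Defs
open import Data.Nat using (ℕ; _≤_; _*_; _+_)
open import Data.Product using (Σ-syntax)

open import Algebra.Solver.CommutativeMonoid as CommutativeMonoidSolver using ()
open import Data.Bool using (Bool; true; false; _xor_)
open import Data.Fin using (Fin; toℕ; inject₁; fromℕ; punchOut; combine; remQuot) renaming (zero to fzero; suc to fsuc)
open import Data.Fin.Patterns using (0F; 1F; 2F)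
open import Data.Fin.Properties using (toℕ-injective; toℕ<n; toℕ-fromℕ<; any?; punchOut-injective; injective⇒≤; combine-injective; combine-remQuot) renaming (_≟_ to _≟ᶠ_)
open import Data.Fin.Subset using (Subset; _∈_; _∉_; _⊆_; _∩_; _∪_; ⁅_⁆; ∣_∣)
open import Data.Fin.Subset.Properties using (_⊆?_; ∩-comm; x∈p∩q⁺; p∩q⊆p; p∩q⊆q; p⊆q⇒∣p∣≤∣q∣; p⊂q⇒∣p∣<∣q∣; x∈p∪q⁻; x∈p∪q⁺; x∈⁅x⁆; x∈⁅y⁆⇒x≡y; x≢y⇒x∉⁅y⁆; ∣⁅x⁆∣≡1; ∪-identityˡ)
open import Data.List using (List; []; _∷_; _++_; [_]; map; filter; length; lookup; reverse; allFin; cartesianProduct; cartesianProductWith)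
open import Data.List.Properties using (map-++; length-++; length-map; unfold-reverse; ++-identityʳ)
open import Data.List.Membership.Propositional using () renaming (_∈_ to _∈ˡ_)
open import Data.List.Membership.Propositional.Properties using (∈-filter⁺; ∈-filter⁻; ∈-map⁺; ∈-map⁻; ∈-++⁺ˡ; ∈-++⁺ʳ; ∈-++⁻; ∈-allFin; ∈-cartesianProduct⁺; ∈-cartesianProductWith⁺; ∈-cartesianProductWith⁻)
open import Data.List.Relation.Binary.Permutation.Propositional using (_↭_; ↭-refl; ↭-sym; ↭-trans; ↭⇒↭ₛ; module PermutationReasoning)
open import Data.List.Relation.Binary.Permutation.Propositional.Properties using (∈-resp-↭; ↭-reverse; ++⁺; ++⁺ˡ; ++-commutativeMonoid)
import Data.List.Relation.Binary.Permutation.Setoid.Properties as Permutationₛ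
open import Data.List.Relation.Unary.All as All using (All; []; _∷_)
import Data.List.Relation.Unary.All.Properties as All
open import Data.List.Relation.Unary.AllPairs using ([]; _∷_)
open import Data.List.Relation.Unary.Any using (here; there)
open import Data.List.Relation.Unary.Unique.Propositional using (Unique)
import Data.List.Relation.Unary.Unique.Propositional.Properties as Unique
open import Data.Nat using (zero; suc; _∸_; _<_; z≤n; s≤s; s≤s⁻¹; _%_)
open import Data.Nat.DivMod using (_mod_; m%n<n; m<n⇒m%n≡m; m%n%n≡m%n; %-distribˡ-+; [m+n]%n≡m%n; [m+kn]%n≡m%n)
open import Data.Nat.Properties
open import Data.Nat.Solver using (module +-*-Solver)
open import Data.Product using (∃; ∃₂; _×_; _,_; proj₁; proj₂; uncurry)
open import Data.Sum as Sum using (_⊎_; inj₁; inj₂; [_,_]′)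
open import Data.Vec using ([]; _∷_; here; there)
open import Function using (_∘_; id; _on_)
open import Function.Definitions using (Injective)
open import Relation.Binary.PropositionalEquality using (_≡_; _≢_; refl; sym; trans; cong; cong₂; subst; subst₂; setoid)
open import Relation.Nullary using (¬_; contradiction; yes; no)
open import Relation.Unary using (Decidable)

open +-*-Solver using (con; _:+_; _:*_; _:=_) renaming (solve to solveℕ)

-- Subsets with two or three elements

∣⁅x⁆∪p∣≡1+∣p∣ : ∀ {n} (x : Fin n) (p : Subset n) → x ∉ p → ∣ ⁅ x ⁆ ∪ p ∣ ≡ suc ∣ p ∣
∣⁅x⁆∪p∣≡1+∣p∣ fzero (true ∷ p) x∉p = contradiction here x∉p
∣⁅x⁆∪p∣≡1+∣p∣ fzero (false ∷ p) x∉p = cong (suc ∘ ∣_∣) (∪-identityˡ p)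
∣⁅x⁆∪p∣≡1+∣p∣ (fsuc x) (true ∷ p) x∉p = cong suc (∣⁅x⁆∪p∣≡1+∣p∣ x p (x∉p ∘ there))
∣⁅x⁆∪p∣≡1+∣p∣ (fsuc x) (false ∷ p) x∉p = ∣⁅x⁆∪p∣≡1+∣p∣ x p (x∉p ∘ there)

∣pair∣≡2 : ∀ {n} {x y : Fin n} → x ≢ y → ∣ ⁅ x ⁆ ∪ ⁅ y ⁆ ∣ ≡ 2
∣pair∣≡2 {x = x} {y} x≢y =
  trans (∣⁅x⁆∪p∣≡1+∣p∣ x ⁅ y ⁆ (x≢y⇒x∉⁅y⁆ x≢y)) (cong suc (∣⁅x⁆∣≡1 y))

nonempty-split : ∀ {n k} (p : Subset n) → ∣ p ∣ ≡ suc k → ∃₂ λ x q → ∣ q ∣ ≡ k × p ≡ ⁅ x ⁆ ∪ q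
nonempty-split (true ∷ p) eq = fzero , false ∷ p , suc-injective eq , cong (true ∷_) (sym (∪-identityˡ p))
nonempty-split (false ∷ p) eq with x , q , ∣q∣ , eq′ ← nonempty-split p eq =
  fsuc x , false ∷ q , ∣q∣ , cong (false ∷_) eq′

∣p∣≡0⇒x∉p : ∀ {n} {p : Subset n} {x} → ∣ p ∣ ≡ 0 → x ∉ p
∣p∣≡0⇒x∉p {p = false ∷ _} eq (there x∈p) = ∣p∣≡0⇒x∉p eq x∈p

∣p∣≡2⇒pair : ∀ {n} (p : Subset n) → ∣ p ∣ ≡ 2 →
  ∃₂ λ x y → x ≢ y × x ∈ p × y ∈ p × (∀ {z} → z ∈ p → z ≡ x ⊎ z ≡ y)
∣p∣≡2⇒pair p eq with nonempty-split p eq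
... | x , q , ∣q∣ , refl with nonempty-split q ∣q∣
... | y , r , ∣r∣ , refl =
  x , y , x≢y , x∈p∪q⁺ (inj₁ (x∈⁅x⁆ x)) , x∈p∪q⁺ (inj₂ (x∈p∪q⁺ (inj₁ (x∈⁅x⁆ y)))) , only
  where
  only : ∀ {z} → z ∈ ⁅ x ⁆ ∪ (⁅ y ⁆ ∪ r) → z ≡ x ⊎ z ≡ y
  only z∈p with x∈p∪q⁻ ⁅ x ⁆ _ z∈p
  ... | inj₁ z∈x = inj₁ (x∈⁅y⁆⇒x≡y x z∈x)
  ... | inj₂ z∈q with x∈p∪q⁻ ⁅ y ⁆ r z∈q
  ...   | inj₁ z∈y = inj₂ (x∈⁅y⁆⇒x≡y y z∈y)
  ...   | inj₂ z∈r = contradiction z∈r (∣p∣≡0⇒x∉p ∣r∣)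
  x≢y : x ≢ y
  -- If the two points were equal, the whole set would lie in a singleton, giving 2 ≤ 1.
  x≢y refl = contradiction (subst₂ _≤_ eq (∣⁅x⁆∣≡1 x) (p⊆q⇒∣p∣≤∣q∣ sub)) λ { (s≤s ()) }
    where
    sub : ⁅ x ⁆ ∪ (⁅ x ⁆ ∪ r) ⊆ ⁅ x ⁆
    sub z∈p with refl ← [ id , id ]′ (only z∈p) = x∈⁅x⁆ x

-- Two common points bound the intersection from below; a point of `p` outside `q` makes it a proper
-- part of a three-element set.
∣p∩q∣≡2 : ∀ {n} {p q : Subset n} {x y z} → ∣ p ∣ ≡ 3 → x ≢ y → x ∈ p → x ∈ q → y ∈ p → y ∈ q →
  z ∈ p → z ∉ q → ∣ p ∩ q ∣ ≡ 2
∣p∩q∣≡2 {p = p} {q} {x} {y} {z} ∣p∣≡3 x≢y x∈p x∈q y∈p y∈q z∈p z∉q = ≤-antisym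
  (≤-pred (≤-trans (p⊂q⇒∣p∣<∣q∣ {p = p ∩ q} {q = p} (p∩q⊆p p q , z , z∈p , z∉q ∘ p∩q⊆q p q)) (≤-reflexive ∣p∣≡3)))
  (≤-trans (≤-reflexive (sym (∣pair∣≡2 x≢y))) (p⊆q⇒∣p∣≤∣q∣ pair⊆))
  where
  pair⊆ : ⁅ x ⁆ ∪ ⁅ y ⁆ ⊆ p ∩ q
  pair⊆ w∈ with x∈p∪q⁻ ⁅ x ⁆ ⁅ y ⁆ w∈
  ... | inj₁ w∈x with refl ← x∈⁅y⁆⇒x≡y x w∈x = x∈p∩q⁺ (x∈p , x∈q)
  ... | inj₂ w∈y with refl ← x∈⁅y⁆⇒x≡y y w∈y = x∈p∩q⁺ (y∈p , y∈q)

-- Hamilton cycles from closed walks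

ExactlyTwo : {A : Set} → (A → Set) → List A → Set
ExactlyTwo P xs = ∃₂ λ u v → u ≢ v × (u ∈ˡ xs × P u) × (v ∈ˡ xs × P v) ×
  (∀ {w} → w ∈ˡ xs → P w → w ≡ u ⊎ w ≡ v)

length-filter-map : ∀ {A B : Set} {P : B → Set} (P? : Decidable P) (f : A → B) xs →
  length (filter P? (map f xs)) ≡ length (filter (P? ∘ f) xs)
length-filter-map P? f [] = refl
length-filter-map P? f (x ∷ xs) with P? (f x)
... | yes _ = cong suc (length-filter-map P? f xs)
... | no  _ = length-filter-map P? f xs

module _ {A : Set} where

  two-element-list : ∀ {xs : List A} {u v} → Unique xs → u ≢ v → u ∈ˡ xs → v ∈ˡ xs →
    (∀ {w} → w ∈ˡ xs → w ≡ u ⊎ w ≡ v) → length xs ≡ 2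
  two-element-list {x ∷ []} _ u≢v (here refl) (here refl) _ = contradiction refl u≢v
  two-element-list {x ∷ y ∷ []} _ _ _ _ _ = refl
  two-element-list {x ∷ y ∷ z ∷ _} ((x≢y ∷ x≢z ∷ _) ∷ (y≢z ∷ _) ∷ _) _ _ _ only
    with only (here refl) | only (there (here refl)) | only (there (there (here refl)))
  ... | inj₁ p | inj₁ q | _      = contradiction (trans p (sym q)) x≢y
  ... | inj₂ p | inj₂ q | _      = contradiction (trans p (sym q)) x≢y
  ... | inj₁ p | inj₂ q | inj₁ r = contradiction (trans p (sym r)) x≢z
  ... | inj₁ p | inj₂ q | inj₂ r = contradiction (trans q (sym r)) y≢z
  ... | inj₂ p | inj₁ q | inj₁ r = contradiction (trans q (sym r)) y≢z
  ... | inj₂ p | inj₁ q | inj₂ r = contradiction (trans p (sym r)) x≢z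

  exactlyTwo⇒length-filter : ∀ {P : A → Set} (P? : Decidable P) {xs} → Unique xs →
    ExactlyTwo P xs → length (filter P? xs) ≡ 2
  exactlyTwo⇒length-filter P? {xs} xs! (u , v , u≢v , (u∈ , Pu) , (v∈ , Pv) , only) =
    two-element-list (Unique.filter⁺ P? xs!) u≢v (∈-filter⁺ P? u∈ Pu) (∈-filter⁺ P? v∈ Pv)
      λ w∈ → let w∈xs , Pw = ∈-filter⁻ P? {xs = xs} w∈ in only w∈xs Pw

module _ {A : Set} (_~_ : A → A → Set) where

  data Walk : A → A → List A → Set where
    stop : ∀ {a} → Walk a a [ a ]
    step : ∀ {a b z xs} → a ~ b → Walk b z xs → Walk a z (a ∷ xs)

module _ {A : Set} {_~_ : A → A → Set} where

  walk-++ : ∀ {a b c d xs ys} → Walk _~_ a b xs → b ~ c → Walk _~_ c d ys → Walk _~_ a d (xs ++ ys)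
  walk-++ stop          b~c w = step b~c w
  walk-++ (step a~a′ v) b~c w = step a~a′ (walk-++ v b~c w)

  walk-reverse : (∀ {a b} → a ~ b → b ~ a) → ∀ {a b xs} → Walk _~_ a b xs → Walk _~_ b a (reverse xs)
  walk-reverse ~-sym stop = stop
  walk-reverse ~-sym {xs = x ∷ xs} (step a~b w) rewrite unfold-reverse x xs =
    walk-++ (walk-reverse ~-sym w) (~-sym a~b) stop

walk-map : ∀ {A B : Set} {_~_ : B → B → Set} (f : A → B) {a b xs} →
  Walk (_~_ on f) a b xs → Walk _~_ (f a) (f b) (map f xs)
walk-map f stop         = stop
walk-map f (step a~b w) = step a~b (walk-map f w)

module _ {n : ℕ} {A : Set} (block : A → Subset n) where

  -- A record rather than the bare equation, so that both labels can be inferred from the type of a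
  -- proof.
  record Meets (i j : A) : Set where
    constructor meets
    field ∣∩∣≡2 : ∣ block i ∩ block j ∣ ≡ 2
  open Meets

  Meets-sym : ∀ {i j} → Meets i j → Meets j i
  Meets-sym {i} {j} (meets p) = meets (trans (cong ∣_∣ (∩-comm (block j) (block i))) p)

  private
    walk-head : ∀ {a z x xs} → Walk Meets a z (x ∷ xs) → a ≡ x
    walk-head stop       = refl
    walk-head (step _ _) = refl

    walk-last : ∀ {a z x xs} → Walk Meets a z (x ∷ xs) →
      block z ≡ lookup (map block (x ∷ xs)) (fromℕ (length (map block xs)))
    walk-last stop                = refl
    walk-last {xs = _ ∷ _} (step _ w) = walk-last w

    walk-step : ∀ {a z x xs} → Walk Meets a z (x ∷ xs) → (i : Fin (length (map block xs))) →
      ∣ lookup (map block (x ∷ xs)) (inject₁ i) ∩ lookup (map block xs) i ∣ ≡ 2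
    walk-step {xs = _ ∷ _} (step a~b w) fzero with refl ← walk-head w = ∣∩∣≡2 a~b
    walk-step {xs = _ ∷ _} (step _ w)   (fsuc i) = walk-step w i

  closed-walk⇒Hamiltonian : ∀ {a z xs} → Walk Meets a z xs → Meets z a → 3 ≤ length xs → Unique xs →
    All (λ i → ∣ block i ∣ ≡ 3) xs →
    (∀ x y → x ≢ y → ExactlyTwo (λ i → x ∈ block i × y ∈ block i) xs) →
    Σ[ T ∈ TTS n ] Hamiltonian (2-BIG T)
  closed-walk⇒Hamiltonian {a} {z} {x ∷ xs} w z~a (s≤s 2≤) xs! tri bal = T , C , λ i → i , id
    where
    cover : ∀ P → ∣ P ∣ ≡ 2 → ExactlyTwo (λ i → P ⊆ block i) (x ∷ xs)
    cover P ∣P∣ with p , q , p≢q , p∈P , q∈P , P⊆pq ← ∣p∣≡2⇒pair P ∣P∣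
                  | bal p q p≢q
    ... | u , v , u≢v , (u∈ , pu) , (v∈ , pv) , only =
      u , v , u≢v , (u∈ , sub pu) , (v∈ , sub pv) , λ w∈ P⊆ → only w∈ (P⊆ p∈P , P⊆ q∈P)
      where
      sub : ∀ {i} → p ∈ block i × q ∈ block i → P ⊆ block i
      sub (p∈ , q∈) r∈P with P⊆pq r∈P
      ... | inj₁ refl = p∈
      ... | inj₂ refl = q∈

    T : TTS n
    T = record
      { blocks   = map block (x ∷ xs)
      ; triples  = All.map⁺ tri
      ; balanced = λ P ∣P∣ → trans (length-filter-map (P ⊆?_) block (x ∷ xs))
                     (exactlyTwo⇒length-filter (λ i → P ⊆? block i) xs! (cover P ∣P∣))
      }

    C : Cycle (2-BIG T)
    C = record
      { k        = length (map block xs)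
      ; 2≤k      = subst (2 ≤_) (sym (length-map block xs)) 2≤
      ; vertex   = id
      ; distinct = id
      ; step     = walk-step w
      ; close    = subst₂ (λ p q → ∣ p ∩ q ∣ ≡ 2) (walk-last w) (cong block (walk-head w)) (∣∩∣≡2 z~a)
      }

-- Zigzag paths

-- Each step reduces to two successors, so that parities and path positions compute by pattern
-- matching.
dbl : ℕ → ℕ
dbl zero    = zero
dbl (suc i) = suc (suc (dbl i))

dbl≡ : ∀ i → dbl i ≡ i + i
dbl≡ zero    = refl
dbl≡ (suc i) = cong suc (trans (cong suc (dbl≡ i)) (sym (+-suc i i)))

data Parity : ℕ → Set where
  even : ∀ i → Parity (dbl i)
  odd  : ∀ i → Parity (suc (dbl i))

parity : ∀ n → Parity n
parity zero = even zero
parity (suc n) with parity n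
... | even i = odd i
... | odd i  = even (suc i)

dbl-injective : ∀ {i j} → dbl i ≡ dbl j → i ≡ j
dbl-injective {zero}  {zero}  _  = refl
dbl-injective {suc i} {suc j} eq = cong suc (dbl-injective (suc-injective (suc-injective eq)))

dbl≢1+dbl : ∀ i j → dbl i ≢ suc (dbl j)
dbl≢1+dbl (suc i) (suc j) eq = dbl≢1+dbl i j (suc-injective (suc-injective eq))

dbl<⇒< : ∀ {i m} → dbl i < m + m → i < m
dbl<⇒< {i} {m} p = ≰⇒> λ m≤i → <⇒≱ p (subst (m + m ≤_) (sym (dbl≡ i)) (+-mono-≤ m≤i m≤i))

-- Pigeonhole: a missed value could be punched out of the codomain, leaving an injection into a
-- smaller set.
injective⇒onto : ∀ {n} {f : Fin n → Fin n} → Injective _≡_ _≡_ f → ∀ y → ∃ λ x → f x ≡ y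
injective⇒onto {suc n} {f} inj y with any? (λ x → f x ≟ᶠ y)
... | yes hit = hit
... | no miss = contradiction
  (injective⇒≤ {f = λ x → punchOut (λ eq → miss (x , sym eq))} (inj ∘ punchOut-injective {i = y} _ _))
  1+n≰n

module Zigzags (h : ℕ) where

  -- `N` unfolds to `suc (suc t)`: a path has positions 0 to t + 1 and edges 0 to `t`. Writing m as
  -- h + 2 builds in m ≥ 2.
  m N t : ℕ
  m = suc (suc h)
  N = m + m
  t = h + m

  -- Congruence modulo `N`

  infix 4 _≈_
  record _≈_ (a b : ℕ) : Set where
    constructor mod≡
    field %≡ : a % N ≡ b % N

  ≈-reflexive : ∀ {a b} → a ≡ b → a ≈ b
  ≈-reflexive eq = mod≡ (cong (_% N) eq)

  ≈-refl : ∀ {a} → a ≈ a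
  ≈-refl = mod≡ refl

  ≈-sym : ∀ {a b} → a ≈ b → b ≈ a
  ≈-sym (mod≡ p) = mod≡ (sym p)

  ≈-trans : ∀ {a b c} → a ≈ b → b ≈ c → a ≈ c
  ≈-trans (mod≡ p) (mod≡ q) = mod≡ (trans p q)

  ≈⇒≡ : ∀ {a b} → a < N → b < N → a ≈ b → a ≡ b
  ≈⇒≡ a<N b<N (mod≡ p) = trans (sym (m<n⇒m%n≡m a<N)) (trans p (m<n⇒m%n≡m b<N))

  +-cong-≈ : ∀ {a b c d} → a ≈ b → c ≈ d → a + c ≈ b + d
  +-cong-≈ {a} {b} {c} {d} (mod≡ p) (mod≡ q) = mod≡
    (trans (%-distribˡ-+ a c N) (trans (cong₂ (λ u v → (u + v) % N) p q) (sym (%-distribˡ-+ b d N))))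

  +N-≈ : ∀ a → a + N ≈ a
  +N-≈ a = mod≡ ([m+n]%n≡m%n a N)

  -- Since `suc t` is N - 1, the multiple `c * suc t` is an additive inverse of `c`; adding it to
  -- both sides cancels `c`.
  +-cancelˡ-≈ : ∀ c {a b} → c + a ≈ c + b → a ≈ b
  +-cancelˡ-≈ c {a} {b} eq =
    ≈-trans (≈-sym (shift a)) (≈-trans (+-cong-≈ (≈-refl {c * suc t}) eq) (shift b))
    where
    shift : ∀ a → c * suc t + (c + a) ≈ a
    shift a = ≈-trans
      (≈-reflexive (solveℕ 3 (λ c t a → c :* (con 1 :+ t) :+ (c :+ a) := a :+ c :* (con 2 :+ t)) refl c t a))
      (mod≡ ([m+kn]%n≡m%n a c N))

  +-cancelʳ-≈ : ∀ c {a b} → a + c ≈ b + c → a ≈ b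
  +-cancelʳ-≈ c {a} {b} eq = +-cancelˡ-≈ c
    (≈-trans (≈-reflexive (+-comm c a)) (≈-trans eq (≈-reflexive (+-comm b c))))

  ⟦_⟧ : ℕ → Fin N
  ⟦ a ⟧ = a mod N

  toℕ-⟦⟧ : ∀ a → toℕ ⟦ a ⟧ ≡ a % N
  toℕ-⟦⟧ a = toℕ-fromℕ< (m%n<n a N)

  toℕ-⟦⟧≈ : ∀ a → toℕ ⟦ a ⟧ ≈ a
  toℕ-⟦⟧≈ a = mod≡ (trans (cong (_% N) (toℕ-⟦⟧ a)) (m%n%n≡m%n a N))

  ⟦⟧-cong : ∀ {a b} → a ≈ b → ⟦ a ⟧ ≡ ⟦ b ⟧
  ⟦⟧-cong {a} {b} (mod≡ p) = toℕ-injective (trans (toℕ-⟦⟧ a) (trans p (sym (toℕ-⟦⟧ b))))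

  ⟦⟧-injective : ∀ {a b} → ⟦ a ⟧ ≡ ⟦ b ⟧ → a ≈ b
  ⟦⟧-injective {a} {b} eq = mod≡ (trans (sym (toℕ-⟦⟧ a)) (trans (cong toℕ eq) (toℕ-⟦⟧ b)))

  ⟦⟧-toℕ : ∀ x → ⟦ toℕ x ⟧ ≡ x
  ⟦⟧-toℕ x = toℕ-injective (trans (toℕ-⟦⟧ (toℕ x)) (m<n⇒m%n≡m (toℕ<n x)))

  complement-unique : ∀ (x : Fin N) {y y′} → toℕ x + toℕ y ≈ toℕ x + toℕ y′ → y ≡ y′
  complement-unique x {y} {y′} eq = toℕ-injective (≈⇒≡ (toℕ<n y) (toℕ<n y′) (+-cancelˡ-≈ (toℕ x) eq))

  dbl<N : ∀ {c} → c < m → suc (dbl c) < N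
  dbl<N {c} (s≤s c≤) = s≤s (s≤s (begin
    dbl c         ≡⟨ dbl≡ c ⟩
    c + c         ≤⟨ +-mono-≤ c≤ c≤ ⟩
    suc h + suc h ≡⟨ +-suc h (suc h) ⟨
    t             ∎))
    where open ≤-Reasoning

  t≡dbl : t ≡ dbl (suc h)
  t≡dbl = trans (+-suc h (suc h)) (sym (dbl≡ (suc h)))

  -- Decomposing the complete graph into zigzags

  Path : Set
  Path = ℕ → ℕ → Fin N

  Edge : Path → ℕ → ℕ → Fin N → Fin N → Set
  Edge f c k x y = (f c k ≡ x × f c (suc k) ≡ y) ⊎ (f c k ≡ y × f c (suc k) ≡ x)

  -- A family of Hamiltonian paths in which the two end points of an edge alternately add up to
  -- 2c + g and 2c.
  record Zigzag (f : Path) : Set where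
    field
      g         : ℕ
      injective : ∀ c {j k} → j < N → k < N → f c j ≡ f c k → j ≡ k
      start     : ∀ c → f c 0 ≡ ⟦ c ⟧
      end       : ∀ c → f c (suc t) ≡ ⟦ c + m ⟧
      sum-even  : ∀ c i → suc (dbl i) < N → toℕ (f c (dbl i)) + toℕ (f c (suc (dbl i))) ≈ dbl c + g
      sum-odd   : ∀ c i → dbl (suc i) < N → toℕ (f c (suc (dbl i))) + toℕ (f c (dbl (suc i))) ≈ dbl c
      centre    : ∀ s → ∃ λ c → c < m × (s ≈ dbl c ⊎ s ≈ dbl c + g)
      apart     : ∀ {c c′} → c < m → c′ < m → ¬ (dbl c ≈ dbl c′ + g)

    surjective : ∀ c x → ∃ λ j → j < N × f c j ≡ x
    surjective c x
      with i , eq ← injective⇒onto {f = f c ∘ toℕ} (toℕ-injective ∘ injective c (toℕ<n _) (toℕ<n _)) x =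
      toℕ i , toℕ<n i , eq

    private
      EdgeSum : ℕ → ℕ → ℕ → Set
      EdgeSum c k s = ((∃ λ i → k ≡ dbl i) × s ≈ dbl c + g) ⊎ ((∃ λ i → k ≡ suc (dbl i)) × s ≈ dbl c)

      sum : ∀ {c k x y} → k ≤ t → Edge f c k x y → EdgeSum c k (toℕ x + toℕ y)
      sum {c} {k} k≤t e with parity k | e
      ... | even i | inj₁ (refl , refl) = inj₁ ((i , refl) , sum-even c i (s≤s (s≤s k≤t)))
      ... | odd i  | inj₁ (refl , refl) = inj₂ ((i , refl) , sum-odd c i (s≤s (s≤s k≤t)))
      ... | even i | inj₂ (refl , refl) =
        inj₁ ((i , refl) , ≈-trans (≈-reflexive (+-comm (toℕ (f c (suc k))) (toℕ (f c k))))
          (sum-even c i (s≤s (s≤s k≤t))))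
      ... | odd i  | inj₂ (refl , refl) =
        inj₂ ((i , refl) , ≈-trans (≈-reflexive (+-comm (toℕ (f c (suc k))) (toℕ (f c k))))
          (sum-odd c i (s≤s (s≤s k≤t))))

      -- Sums of the same kind reduce to comparing 2c with 2c′, both below `N`, so congruence is
      -- equality. Sums of different kinds never agree, by `apart`.
      same-centre : ∀ {c c′ k k′ s} → c < m → c′ < m → EdgeSum c k s → EdgeSum c′ k′ s → c ≡ c′
      same-centre {c} {c′} c< c′< (inj₁ (_ , p)) (inj₁ (_ , q)) =
        dbl-injective (≈⇒≡ (<-trans (n<1+n _) (dbl<N c<)) (<-trans (n<1+n _) (dbl<N c′<))
          (+-cancelʳ-≈ g (≈-trans (≈-sym p) q)))
      same-centre c< c′< (inj₂ (_ , p)) (inj₂ (_ , q)) =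
        dbl-injective (≈⇒≡ (<-trans (n<1+n _) (dbl<N c<)) (<-trans (n<1+n _) (dbl<N c′<)) (≈-trans (≈-sym p) q))
      same-centre c< c′< (inj₁ (_ , p)) (inj₂ (_ , q)) = contradiction (≈-trans (≈-sym q) p) (apart c′< c<)
      same-centre c< c′< (inj₂ (_ , p)) (inj₁ (_ , q)) = contradiction (≈-trans (≈-sym p) q) (apart c< c′<)

    -- The sum of the end points fixes the class, and injectivity along the path then fixes the
    -- position. Opposite orientations would force k = k + 2.
    edge-unique : ∀ {c c′ k k′ x y} → c < m → c′ < m → k ≤ t → k′ ≤ t →
      Edge f c k x y → Edge f c′ k′ x y → c ≡ c′ × k ≡ k′
    edge-unique {c} {c′} {k} {k′} c< c′< k≤ k′≤ e e′ with refl ← same-centre c< c′< (sum k≤ e) (sum k′≤ e′) =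
      refl , go e e′
      where
      bound : ∀ {k} → k ≤ t → k < N
      bound k≤ = s≤s (≤-trans k≤ (n≤1+n _))
      crossed : f c k ≡ f c (suc k′) → f c (suc k) ≡ f c k′ → k ≡ suc (suc k)
      crossed p q = trans (injective c (bound k≤) (s≤s (s≤s k′≤)) p)
        (cong suc (sym (injective c (s≤s (s≤s k≤)) (bound k′≤) q)))
      go : ∀ {x y} → Edge f c k x y → Edge f c k′ x y → k ≡ k′
      go (inj₁ (p , _)) (inj₁ (q , _)) = injective c (bound k≤) (bound k′≤) (trans p (sym q))
      go (inj₂ (p , _)) (inj₂ (q , _)) = injective c (bound k≤) (bound k′≤) (trans p (sym q))
      go (inj₁ (p , p′)) (inj₂ (q , q′)) = contradiction (crossed (trans p (sym q′)) (trans p′ (sym q))) (<⇒≢ (m<n⇒m<1+n (n<1+n k)))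
      go (inj₂ (p , p′)) (inj₁ (q , q′)) = contradiction (crossed (trans p (sym q′)) (trans p′ (sym q))) (<⇒≢ (m<n⇒m<1+n (n<1+n k)))

    -- The sum x + y selects a class and a parity of edges. The neighbour of `x` through an edge of
    -- that parity has the right sum with `x`, so it is `y`.
    edge-exists : ∀ x y → x ≢ y → ∃₂ λ c k → c < m × k ≤ t × Edge f c k x y
    edge-exists x y x≢y
      with c , c< , s ← centre (toℕ x + toℕ y)
      with j , j< , fj≡x ← surjective c x = c , find s
      where
      s′ = toℕ x + toℕ y
      partner : ∀ j′ {s} → s′ ≈ s → toℕ (f c j) + toℕ (f c j′) ≈ s → f c j′ ≡ y
      partner j′ p q = complement-unique x (≈-trans (subst (λ z → toℕ z + toℕ (f c j′) ≈ _) fj≡x q) (≈-sym p))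
      flip-sum : ∀ {a b s} → a + b ≈ s → b + a ≈ s
      flip-sum {a} {b} p = ≈-trans (≈-reflexive (+-comm b a)) p
      c+m-doubled : ⟦ c + m + (c + m) ⟧ ≡ ⟦ c + c ⟧
      c+m-doubled = ⟦⟧-cong (≈-trans
        (≈-reflexive (solveℕ 2 (λ c m → (c :+ m) :+ (c :+ m) := (c :+ c) :+ (m :+ m)) refl c m)) (+N-≈ (c + c)))
      -- An end point of the path would be its own partner.
      end-point : ∀ e {A : Set} → x ≡ ⟦ e ⟧ → ⟦ e + e ⟧ ≡ ⟦ c + c ⟧ → s′ ≈ dbl c → A
      end-point e x≡ 2e≡ p = contradiction (complement-unique x (≈-trans twice (≈-sym p))) x≢y
        where
        x≈ : toℕ x ≈ e
        x≈ = ≈-trans (≈-reflexive (cong toℕ x≡)) (toℕ-⟦⟧≈ e)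
        twice : toℕ x + toℕ x ≈ dbl c
        twice = ≈-trans (+-cong-≈ x≈ x≈) (≈-trans (⟦⟧-injective 2e≡) (≈-reflexive (sym (dbl≡ c))))
      find : s′ ≈ dbl c ⊎ s′ ≈ dbl c + g → ∃ λ k → c < m × k ≤ t × Edge f c k x y
      find (inj₂ p) with parity j
      ... | even i = dbl i , c< , k≤ , inj₁ (fj≡x , partner (suc j) p (sum-even c i (s≤s (s≤s k≤))))
        where
        k≤ : dbl i ≤ t
        -- The last position `suc t` is odd, so an even position always has a successor on the path.
        k≤ = s≤s⁻¹ (≤∧≢⇒< (s≤s⁻¹ j<) (λ eq → dbl≢1+dbl i (suc h) (trans eq (cong suc t≡dbl))))
      ... | odd i  = dbl i , c< , s≤s⁻¹ (s≤s⁻¹ j<) ,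
        inj₂ (partner (dbl i) p (flip-sum {toℕ (f c (dbl i))} (sum-even c i j<)) , fj≡x)
      find (inj₁ p) with parity j
      ... | even zero = end-point c (trans (sym fj≡x) (start c)) refl p
      ... | even (suc i) = suc (dbl i) , c< , s≤s⁻¹ (s≤s⁻¹ j<) ,
        inj₂ (partner (suc (dbl i)) p (flip-sum {toℕ (f c (suc (dbl i)))} (sum-odd c i j<)) , fj≡x)
      ... | odd i with j ≟ suc t
      ...   | no j≢ = suc (dbl i) , c< , s≤s⁻¹ (≤∧≢⇒< (s≤s⁻¹ j<) j≢) ,
        inj₁ (fj≡x , partner (suc j) p (sum-odd c i (s≤s (≤∧≢⇒< (s≤s⁻¹ j<) j≢))))
      ...   | yes eq = end-point (c + m) (trans (sym fj≡x) (trans (cong (f c) eq) (end c))) c+m-doubled p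

  -- The two concrete zigzag families

  private
    -- The accumulator `i` counts the pairs of positions already passed.
    offset′ : ℕ → ℕ → ℕ
    offset′ i 0             = suc t ∸ i
    offset′ i 1             = i
    offset′ i (suc (suc j)) = offset′ (suc i) j

    offset′-even : ∀ i j → offset′ i (dbl j) ≡ suc t ∸ (j + i)
    offset′-even i zero    = refl
    offset′-even i (suc j) = trans (offset′-even (suc i) j) (cong (suc t ∸_) (+-suc j i))

    offset′-odd : ∀ i j → offset′ i (suc (dbl j)) ≡ j + i
    offset′-odd i zero    = refl
    offset′-odd i (suc j) = trans (offset′-odd (suc i) j) (+-suc j i)

  -- The sequence N − 1, 0, N − 2, 1, N − 3, 2, …
  offset : ℕ → ℕ
  offset = offset′ 0

  offset-even : ∀ i → offset (dbl i) ≡ suc t ∸ i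
  offset-even i = trans (offset′-even 0 i) (cong (suc t ∸_) (+-identityʳ i))

  offset-odd : ∀ i → offset (suc (dbl i)) ≡ i
  offset-odd i = trans (offset′-odd 0 i) (+-identityʳ i)

  half≤ : ∀ {i} → i < m → i ≤ suc t
  half≤ i< = ≤-trans (<⇒≤ i<) (m≤n+m m (suc h))

  even-half : ∀ {i} → dbl i < N → i < m
  even-half = dbl<⇒<

  odd-half : ∀ {i} → suc (dbl i) < N → i < m
  odd-half p = dbl<⇒< (<-trans (n<1+n _) p)

  offset≤ : ∀ {j} → j < N → offset j ≤ suc t
  offset≤ {j} j< with parity j
  ... | even i rewrite offset-even i = m∸n≤m (suc t) i
  ... | odd i  rewrite offset-odd i  = half≤ (odd-half j<)

  -- With `i` below `m` the left side is at least `m`, so values at even and odd positions cannot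
  -- collide.
  offset-even≢odd : ∀ {i j} → i < m → j < m → suc t ∸ i ≢ j
  offset-even≢odd {i} i< j< refl = <⇒≢ (+-mono-≤-< (s≤s⁻¹ j<) i<) (m∸n+n≡m (half≤ i<))

  offset-injective : ∀ {j k} → j < N → k < N → offset j ≡ offset k → j ≡ k
  offset-injective {j} {k} j< k< eq with parity j | parity k
  ... | even i | even i′ rewrite offset-even i | offset-even i′ =
    cong dbl (∸-cancelˡ-≡ (half≤ (even-half j<)) (half≤ (even-half k<)) eq)
  ... | odd i  | odd i′  rewrite offset-odd i | offset-odd i′ = cong (suc ∘ dbl) eq
  ... | even i | odd i′  rewrite offset-even i | offset-odd i′ =
    contradiction eq (offset-even≢odd (even-half j<) (odd-half k<))
  ... | odd i  | even i′ rewrite offset-odd i | offset-even i′ =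
    contradiction (sym eq) (offset-even≢odd (even-half k<) (odd-half j<))

  -- p c = c, c + 1, c − 1, c + 2, …, c + m  and its mirror image  q c = c, c − 1, c + 1, c − 2, …, c + m.
  p q : Path
  p c j = ⟦ c + suc (offset j) ⟧
  q c j = ⟦ c + (suc t ∸ offset j) ⟧

  p-even : ∀ c i → p c (dbl i) ≡ ⟦ c + suc (suc t ∸ i) ⟧
  p-even c i = cong (λ z → ⟦ c + suc z ⟧) (offset-even i)

  p-odd : ∀ c i → p c (suc (dbl i)) ≡ ⟦ c + suc i ⟧
  p-odd c i = cong (λ z → ⟦ c + suc z ⟧) (offset-odd i)

  q-even : ∀ c {i} → i ≤ suc t → q c (dbl i) ≡ ⟦ c + i ⟧
  q-even c {i} i≤ = cong (λ z → ⟦ c + z ⟧) (trans (cong (suc t ∸_) (offset-even i)) (m∸[m∸n]≡n i≤))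

  q-odd : ∀ c i → q c (suc (dbl i)) ≡ ⟦ c + (suc t ∸ i) ⟧
  q-odd c i = cong (λ z → ⟦ c + (suc t ∸ z) ⟧) (offset-odd i)

  ⟦⟧-sum : ∀ {x y} a b {s} → x ≡ ⟦ a ⟧ → y ≡ ⟦ b ⟧ → a + b ≈ s → toℕ x + toℕ y ≈ s
  ⟦⟧-sum a b refl refl = ≈-trans (+-cong-≈ (toℕ-⟦⟧≈ a) (toℕ-⟦⟧≈ b))

  1+t≡odd : suc t ≡ suc (dbl (suc h))
  1+t≡odd = cong suc t≡dbl

  centre-parity : ∀ s → ∃ λ c → c < m × (s ≈ dbl c ⊎ s ≈ suc (dbl c))
  centre-parity s = split (s % N) (m%n<n s N) (mod≡ (sym (m%n%n≡m%n s N)))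
    where
    split : ∀ r → r < N → s ≈ r → ∃ λ c → c < m × (s ≈ dbl c ⊎ s ≈ suc (dbl c))
    split r r< s≈ with parity r
    ... | even c = c , even-half r< , inj₁ s≈
    ... | odd c  = c , odd-half r< , inj₂ s≈

  p-zigzag : Zigzag p
  p-zigzag = record
    { g         = 1
    ; injective = λ c j< k< eq → offset-injective j< k< (≈⇒≡ (s≤s (offset≤ j<)) (s≤s (offset≤ k<))
                    (+-cancelˡ-≈ 1 (+-cancelˡ-≈ c (⟦⟧-injective eq))))
    ; start     = λ c → ⟦⟧-cong (+N-≈ c)
    ; end       = λ c → trans (cong (p c) 1+t≡odd) (p-odd c (suc h))
    ; sum-even  = λ c i lt → ⟦⟧-sum (c + suc (suc t ∸ i)) (c + suc i) (p-even c i) (p-odd c i)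
                    (≈-trans (≈-reflexive (even-sum c i (m∸n+n≡m (half≤ (odd-half lt))))) (+N-≈ (dbl c + 1)))
    ; sum-odd   = λ c i lt → ⟦⟧-sum (c + suc i) (c + suc (t ∸ i)) (p-odd c i) (p-even c (suc i))
                    (≈-trans (≈-reflexive (odd-sum c i (m∸n+n≡m (s≤s⁻¹ (half≤ (even-half lt)))))) (+N-≈ (dbl c)))
    ; centre    = λ s → let c , c< , eq = centre-parity s in
                    c , c< , Sum.map₂ (λ e → ≈-trans e (≈-reflexive (+-comm 1 (dbl c)))) eq
    ; apart     = λ {c} {c′} c< c′< eq → dbl≢1+dbl c c′
                    (≈⇒≡ (<-trans (n<1+n _) (dbl<N c<)) (dbl<N c′<) (≈-trans eq (≈-reflexive (+-comm (dbl c′) 1))))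
    }
    where
    even-sum : ∀ c i {d} → d + i ≡ suc t → c + suc d + (c + suc i) ≡ dbl c + 1 + N
    even-sum c i {d} eq rewrite dbl≡ c | sym eq =
      solveℕ 3 (λ c d i → c :+ (con 1 :+ d) :+ (c :+ (con 1 :+ i)) := c :+ c :+ con 1 :+ (con 1 :+ (d :+ i))) refl c d i
    odd-sum : ∀ c i {d} → d + i ≡ t → c + suc i + (c + suc d) ≡ dbl c + N
    odd-sum c i {d} eq rewrite dbl≡ c | sym eq =
      solveℕ 3 (λ c d i → c :+ (con 1 :+ i) :+ (c :+ (con 1 :+ d)) := c :+ c :+ (con 2 :+ (d :+ i))) refl c d i

  q-zigzag : Zigzag q
  q-zigzag = record
    { g         = suc t
    ; injective = λ c {j} {k} j< k< eq → offset-injective j< k< (∸-cancelˡ-≡ (offset≤ j<) (offset≤ k<)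
                    (≈⇒≡ (s≤s (m∸n≤m (suc t) (offset j))) (s≤s (m∸n≤m (suc t) (offset k)))
                      (+-cancelˡ-≈ c (⟦⟧-injective eq))))
    ; start     = λ c → trans (q-even c z≤n) (cong ⟦_⟧ (+-identityʳ c))
    ; end       = λ c → trans (cong (q c) 1+t≡odd)
                    (trans (q-odd c (suc h)) (cong (λ z → ⟦ c + z ⟧) (m+n∸m≡n (suc h) m)))
    ; sum-even  = λ c i lt → ⟦⟧-sum (c + i) (c + (suc t ∸ i)) (q-even c (half≤ (odd-half lt))) (q-odd c i)
                    (≈-reflexive (even-sum c i (m∸n+n≡m (half≤ (odd-half lt)))))
    ; sum-odd   = λ c i lt → ⟦⟧-sum (c + (suc t ∸ i)) (c + suc i) (q-odd c i) (q-even c (half≤ (even-half lt)))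
                    (≈-trans (≈-reflexive (odd-sum c i (m∸n+n≡m (≤-trans (n≤1+n i) (half≤ (even-half lt))))))
                      (+N-≈ (dbl c)))
    ; centre    = centre
    -- Here g = N - 1 acts as -1; adding 1 to both sides compares the odd 2c + 1 with the even 2c′.
    ; apart     = λ {c} {c′} c< c′< eq → dbl≢1+dbl c′ c (sym
                    (≈⇒≡ (dbl<N c<) (<-trans (n<1+n _) (dbl<N c′<))
                      (≈-trans (+-cong-≈ (≈-refl {1}) eq)
                        (≈-trans (≈-reflexive (sym (+-suc (dbl c′) (suc t)))) (+N-≈ (dbl c′))))))
    }
    where
    even-sum : ∀ c i {d} → d + i ≡ suc t → c + i + (c + d) ≡ dbl c + suc t
    even-sum c i {d} eq rewrite dbl≡ c | sym eq =
      solveℕ 3 (λ c d i → c :+ i :+ (c :+ d) := c :+ c :+ (d :+ i)) refl c d i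
    odd-sum : ∀ c i {d} → d + i ≡ suc t → c + d + (c + suc i) ≡ dbl c + N
    odd-sum c i {d} eq rewrite dbl≡ c | sym eq =
      solveℕ 3 (λ c d i → c :+ d :+ (c :+ (con 1 :+ i)) := c :+ c :+ (con 1 :+ (d :+ i))) refl c d i
    centre : ∀ s → ∃ λ c → c < m × (s ≈ dbl c ⊎ s ≈ dbl c + suc t)
    centre s with centre-parity s
    ... | c , c< , inj₁ eq = c , c< , inj₁ eq
    -- An odd sum 2c + 1 is 2(c + 1) - 1 and so belongs to the next class; from the last class this
    -- wraps round to class 0.
    ... | c , c< , inj₂ eq with c ≟ suc h
    ...   | yes refl = 0 , s≤s z≤n , inj₂ (≈-trans eq (≈-reflexive (sym 1+t≡odd)))
    ...   | no c≢    = suc c , s≤s (≤∧≢⇒< (s≤s⁻¹ c<) c≢) ,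
      inj₂ (≈-trans eq (≈-trans (≈-sym (+N-≈ (suc (dbl c)))) (≈-reflexive (cong suc (+-suc (dbl c) (suc t))))))

  -- At odd positions both families have edge sum 2c, so within a class they share these edges,
  -- traversed in opposite directions.
  rung-odd : ∀ c i → suc i < m → p c (suc (dbl i)) ≡ q c (dbl (suc i)) × p c (dbl (suc i)) ≡ q c (suc (dbl i))
  rung-odd c i i< = trans (p-odd c i) (sym (q-even c (half≤ i<))) ,
    trans (p-even c (suc i)) (trans (cong (λ z → ⟦ c + z ⟧) (sym (+-∸-assoc 1 (s≤s⁻¹ (half≤ i<))))) (sym (q-odd c i)))

  -- At even positions the edge sum is 2c + 1 on `p c` and 2(c + 1) - 1 on `q (suc c)`; this links a
  -- class to the next one.
  rung-even : ∀ c i → i < m → p c (dbl i) ≡ q (suc c) (suc (dbl i)) × p c (suc (dbl i)) ≡ q (suc c) (dbl i)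
  rung-even c i i< = trans (p-even c i) (trans (cong ⟦_⟧ (+-suc c _)) (sym (q-odd (suc c) i))) ,
    trans (p-odd c i) (trans (cong ⟦_⟧ (+-suc c i)) (sym (q-even (suc c) (half≤ i<))))

  -- Class m would be class 0 run backwards, so the last edge of `p` in the last class is the first
  -- edge of `q` in class 0, now in the same direction.
  rung-wrap : p (suc h) t ≡ q 0 0 × p (suc h) (suc t) ≡ q 0 1
  rung-wrap = trans (cong (p (suc h)) t≡dbl) (trans (p-even (suc h) (suc h))
      (trans (⟦⟧-cong (≈-trans
          (≈-reflexive (trans (+-suc (suc h) _) (cong suc (m+[n∸m]≡n (half≤ (n<1+n _)))))) (+N-≈ 0)))
        (sym (Zigzag.start q-zigzag 0)))) ,
    trans (Zigzag.end p-zigzag (suc h)) (sym (q-odd 0 0))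

-- The triple system

next : Fin 3 → Fin 3
next 0F = 1F
next 1F = 2F
next 2F = 0F

next≢ : ∀ i → next i ≢ i
next≢ 0F ()
next≢ 1F ()
next≢ 2F ()

next²≢ : ∀ i → next (next i) ≢ i
next²≢ 0F ()
next²≢ 1F ()
next²≢ 2F ()

data Levels : Fin 3 → Fin 3 → Set where
  same  : ∀ {i} → Levels i i
  above : ∀ {i} → Levels i (next i)
  below : ∀ {i} → Levels (next i) i

levels : ∀ i j → Levels i j
levels 0F 0F = same
levels 0F 1F = above
levels 0F 2F = below
levels 1F 0F = below
levels 1F 1F = same
levels 1F 2F = above
levels 2F 0F = above
levels 2F 1F = below
levels 2F 2F = same

bit : Fin 3 → Bool × Bool → Bool
bit 0F (b₀ , b₁) = b₀
bit 1F (b₀ , b₁) = b₁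
bit 2F (b₀ , b₁) = b₀ xor b₁

-- The three bits of a face sum to zero modulo 2, so two of them determine the third. Hence each
-- octahedron edge between different levels lies on exactly one of the chosen faces.
face : Fin 3 → Bool → Bool → Bool × Bool
face 0F β γ = β , γ
face 1F β γ = β xor γ , β
face 2F β γ = γ , β xor γ

bit-face : ∀ i β γ → bit i (face i β γ) ≡ β
bit-face 0F _     _     = refl
bit-face 1F _     _     = refl
bit-face 2F false false = refl
bit-face 2F false true  = refl
bit-face 2F true  false = refl
bit-face 2F true  true  = refl

bit-next-face : ∀ i β γ → bit (next i) (face i β γ) ≡ γ
bit-next-face 0F _     _     = refl
bit-next-face 1F false false = refl
bit-next-face 1F false true  = refl
bit-next-face 1F true  false = refl
bit-next-face 1F true  true  = refl
bit-next-face 2F _     _     = refl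

face-bit : ∀ i s → face i (bit i s) (bit (next i) s) ≡ s
face-bit 0F _               = refl
face-bit 1F (false , false) = refl
face-bit 1F (false , true)  = refl
face-bit 1F (true  , false) = refl
face-bit 1F (true  , true)  = refl
face-bit 2F (false , false) = refl
face-bit 2F (false , true)  = refl
face-bit 2F (true  , false) = refl
face-bit 2F (true  , true)  = refl

-- Labels of blocks within a class c: `tri (b₀ , b₁)` is the octahedron face with the bits b₀, b₁ and
-- b₀ xor b₁ on the three levels, and `rail i b k` joins the k-th edge of a zigzag through c on level i
-- to the apex c + bm on the next level.
data Local : Set where
  tri  : Bool × Bool → Local
  rail : Fin 3 → Bool → ℕ → Local

Label : Set
Label = ℕ × Local

module Blocks (h : ℕ) where
  open Zigzags h

  Point : Set
  Point = Fin 3 × Fin N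

  at : ℕ → Bool → Fin N
  at c false = ⟦ c ⟧
  at c true  = ⟦ c + m ⟧

  -- For classes below `m`, bit `false` gives a residue below `m` and bit `true` one from `m` on.
  at-injective : ∀ {c c′} b b′ → c < m → c′ < m → at c b ≡ at c′ b′ → c ≡ c′ × b ≡ b′
  at-injective false false c< c′< eq =
    ≈⇒≡ (≤-trans c< (m≤m+n m m)) (≤-trans c′< (m≤m+n m m)) (⟦⟧-injective eq) , refl
  at-injective true true c< c′< eq =
    ≈⇒≡ (≤-trans c< (m≤m+n m m)) (≤-trans c′< (m≤m+n m m)) (+-cancelʳ-≈ m (⟦⟧-injective eq)) , refl
  at-injective {c} {c′} false true c< c′< eq = contradiction
    (≈⇒≡ (≤-trans c< (m≤m+n m m)) (+-monoˡ-< m c′<) (⟦⟧-injective eq)) (<⇒≢ (≤-trans c< (m≤n+m m c′)))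
  at-injective {c} {c′} true false c< c′< eq = contradiction
    (≈⇒≡ (≤-trans c′< (m≤m+n m m)) (+-monoˡ-< m c<) (≈-sym (⟦⟧-injective eq))) (<⇒≢ (≤-trans c′< (m≤n+m m c)))

  at-surjective : ∀ x → ∃₂ λ c b → c < m × at c b ≡ x
  at-surjective x with <-≤-connex (toℕ x) m
  ... | inj₁ x< = toℕ x , false , x< , ⟦⟧-toℕ x
  ... | inj₂ m≤ = toℕ x ∸ m , true , +-cancelʳ-< m (toℕ x ∸ m) m (subst (_< N) (sym (m∸n+n≡m m≤)) (toℕ<n x)) ,
    trans (cong ⟦_⟧ (m∸n+n≡m m≤)) (⟦⟧-toℕ x)

  path : Fin 3 → Bool → Path
  path 0F       false = q
  path 0F       true  = p
  path (fsuc _) _     = p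

  zigzag : ∀ i b → Zigzag (path i b)
  zigzag 0F       false = q-zigzag
  zigzag 0F       true  = p-zigzag
  zigzag (fsuc _) _     = p-zigzag

  module Z i b = Zigzag (zigzag i b)

  corners : Label → Point × Point × Point
  corners (c , tri s)      = (0F , at c (bit 0F s)) , (1F , at c (bit 1F s)) , (2F , at c (bit 2F s))
  corners (c , rail i b k) = (i , path i b c k) , (i , path i b c (suc k)) , (next i , at c b)

  infix 4 _∈ᵇ_ _∉ᵇ_
  _∈ᵇ_ _∉ᵇ_ : Point → Label → Set
  u ∈ᵇ l = let x , y , z = corners l in u ≡ x ⊎ u ≡ y ⊎ u ≡ z
  u ∉ᵇ l = ¬ (u ∈ᵇ l)

  Valid : Label → Set
  Valid (c , tri _)      = c < m
  Valid (c , rail _ _ k) = c < m × k ≤ t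

  encode : Point → Fin (3 * N)
  encode = uncurry combine

  encode-injective : ∀ {u v} → encode u ≡ encode v → u ≡ v
  encode-injective {i , x} {j , y} eq with refl , refl ← combine-injective i x j y eq = refl

  decode : Fin (3 * N) → Point
  decode = remQuot {3} N

  encode-decode : ∀ x → encode (decode x) ≡ x
  encode-decode = combine-remQuot {3} N

  block : Label → Subset (3 * N)
  block l = let x , y , z = corners l in ⁅ encode x ⁆ ∪ (⁅ encode y ⁆ ∪ ⁅ encode z ⁆)

  ∈-block⁺ : ∀ {u} l → u ∈ᵇ l → encode u ∈ block l
  ∈-block⁺ l (inj₁ refl)        = x∈p∪q⁺ (inj₁ (x∈⁅x⁆ _))
  ∈-block⁺ l (inj₂ (inj₁ refl)) = x∈p∪q⁺ (inj₂ (x∈p∪q⁺ (inj₁ (x∈⁅x⁆ _))))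
  ∈-block⁺ l (inj₂ (inj₂ refl)) = x∈p∪q⁺ (inj₂ (x∈p∪q⁺ (inj₂ (x∈⁅x⁆ _))))

  ∈-block⁻ : ∀ {u} l → encode u ∈ block l → u ∈ᵇ l
  ∈-block⁻ l u∈ = Sum.map single (Sum.map single single ∘ x∈p∪q⁻ _ _) (x∈p∪q⁻ _ _ u∈)
    where
    single : ∀ {u v} → encode u ∈ ⁅ encode v ⁆ → u ≡ v
    single = encode-injective ∘ x∈⁅y⁆⇒x≡y _

  ∈-tri⁺ : ∀ c i s → (i , at c (bit i s)) ∈ᵇ (c , tri s)
  ∈-tri⁺ c 0F s = inj₁ refl
  ∈-tri⁺ c 1F s = inj₂ (inj₁ refl)
  ∈-tri⁺ c 2F s = inj₂ (inj₂ refl)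

  ∈-tri⁻ : ∀ c i s {x} → (i , x) ∈ᵇ (c , tri s) → x ≡ at c (bit i s)
  ∈-tri⁻ _ _ _ (inj₁ refl)        = refl
  ∈-tri⁻ _ _ _ (inj₂ (inj₁ refl)) = refl
  ∈-tri⁻ _ _ _ (inj₂ (inj₂ refl)) = refl

  ∈-rail⁻ : ∀ {j x c i b k} → (j , x) ∈ᵇ (c , rail i b k) →
    (j ≡ i × (path i b c k ≡ x ⊎ path i b c (suc k) ≡ x)) ⊎ (j ≡ next i × at c b ≡ x)
  ∈-rail⁻ (inj₁ refl)        = inj₁ (refl , inj₁ refl)
  ∈-rail⁻ (inj₂ (inj₁ refl)) = inj₁ (refl , inj₂ refl)
  ∈-rail⁻ (inj₂ (inj₂ refl)) = inj₂ (refl , refl)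

  ≤t⇒<N : ∀ {k} → k ≤ t → k < N
  ≤t⇒<N k≤ = s≤s (m≤n⇒m≤1+n k≤)

  <N⇒≤t : ∀ {k} → suc k < N → k ≤ t
  <N⇒≤t k< = s≤s⁻¹ (s≤s⁻¹ k<)

  path-≢ : ∀ i b c {j k} → j < N → k < N → j ≢ k → path i b c j ≢ path i b c k
  path-≢ i b c j< k< j≢k = j≢k ∘ Z.injective i b c j< k<

  corners-distinct : ∀ l → Valid l → let x , y , z = corners l in x ≢ y × x ≢ z × y ≢ z
  corners-distinct (c , tri _) _ = (λ ()) , (λ ()) , λ ()
  corners-distinct (c , rail i b k) (_ , k≤) =
    path-≢ i b c (≤t⇒<N k≤) (s≤s (s≤s k≤)) (<⇒≢ (n<1+n k)) ∘ cong proj₂ ,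
    next≢ i ∘ sym ∘ cong proj₁ , next≢ i ∘ sym ∘ cong proj₁

  ∣block∣≡3 : ∀ l → Valid l → ∣ block l ∣ ≡ 3
  ∣block∣≡3 l v with x≢y , x≢z , y≢z ← corners-distinct l v =
    trans (∣⁅x⁆∪p∣≡1+∣p∣ _ _ λ x∈ →
            [ x≢y ∘ encode-injective ∘ x∈⁅y⁆⇒x≡y _ , x≢z ∘ encode-injective ∘ x∈⁅y⁆⇒x≡y _ ]′ (x∈p∪q⁻ _ _ x∈))
      (cong suc (∣pair∣≡2 (y≢z ∘ encode-injective)))

  -- Adjacent blocks

  infix 4 _~_
  _~_ : Label → Label → Set
  _~_ = Meets block

  ~-intro : ∀ {l l′ u v w} → Valid l → u ≢ v → u ∈ᵇ l → u ∈ᵇ l′ → v ∈ᵇ l → v ∈ᵇ l′ → w ∈ᵇ l → w ∉ᵇ l′ → l ~ l′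
  ~-intro {l} {l′} valid u≢v u∈l u∈l′ v∈l v∈l′ w∈l w∉l′ = meets
    (∣p∩q∣≡2 {p = block l} {q = block l′} (∣block∣≡3 l valid) (u≢v ∘ encode-injective)
      (∈-block⁺ l u∈l) (∈-block⁺ l′ u∈l′) (∈-block⁺ l v∈l) (∈-block⁺ l′ v∈l′) (∈-block⁺ l w∈l) (w∉l′ ∘ ∈-block⁻ l′))

  ~-sym : ∀ {l l′} → l ~ l′ → l′ ~ l
  ~-sym = Meets-sym block

  rail~rail : ∀ {c i b k} → c < m → suc k ≤ t → (c , rail i b k) ~ (c , rail i b (suc k))
  rail~rail {c} {i} {b} {k} c< k< = ~-intro {u = i , path i b c (suc k)} {v = next i , at c b} {w = i , path i b c k}
    (c< , <⇒≤ k<) (next≢ i ∘ sym ∘ cong proj₁)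
    (inj₂ (inj₁ refl)) (inj₁ refl) (inj₂ (inj₂ refl)) (inj₂ (inj₂ refl)) (inj₁ refl)
    λ where
      (inj₁ eq)        → path-≢ i b c k<N (s≤s (m≤n⇒m≤1+n k<)) (<⇒≢ (n<1+n k)) (cong proj₂ eq)
      (inj₂ (inj₁ eq)) → path-≢ i b c k<N (s≤s (s≤s k<)) (<⇒≢ (m<n⇒m<1+n (n<1+n k))) (cong proj₂ eq)
      (inj₂ (inj₂ eq)) → next≢ i (sym (cong proj₁ eq))
    where
    k<N : k < N
    k<N = ≤t⇒<N (<⇒≤ k<)

  -- Blocks over the same edge share it, and different bits keep their apexes apart whatever their
  -- classes.
  rung : ∀ {c c′ i b b′ k k′} → c < m → c′ < m → k ≤ t → b ≢ b′ →
    Edge (path i b′) c′ k′ (path i b c k) (path i b c (suc k)) →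
    (c , rail i b k) ~ (c′ , rail i b′ k′)
  rung {c} {c′} {i} {b} {b′} {k} {k′} c< c′< k≤ b≢b′ e =
    ~-intro {c , rail i b k} {c′ , rail i b′ k′} {i , path i b c k} {i , path i b c (suc k)} {next i , at c b}
      (c< , k≤) (path-≢ i b c (≤t⇒<N k≤) (s≤s (s≤s k≤)) (<⇒≢ (n<1+n k)) ∘ cong proj₂)
      (inj₁ refl) (fst e) (inj₂ (inj₁ refl)) (snd e) (inj₂ (inj₂ refl))
      λ where
        (inj₁ eq)        → next≢ i (cong proj₁ eq)
        (inj₂ (inj₁ eq)) → next≢ i (cong proj₁ eq)
        (inj₂ (inj₂ eq)) → b≢b′ (proj₂ (at-injective b b′ c< c′< (cong proj₂ eq)))
    where
    fst : ∀ {x y} → Edge (path i b′) c′ k′ x y → (i , x) ∈ᵇ (c′ , rail i b′ k′)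
    fst (inj₁ (refl , refl)) = inj₁ refl
    fst (inj₂ (refl , refl)) = inj₂ (inj₁ refl)
    snd : ∀ {x y} → Edge (path i b′) c′ k′ x y → (i , y) ∈ᵇ (c′ , rail i b′ k′)
    snd (inj₁ (refl , refl)) = inj₂ (inj₁ refl)
    snd (inj₂ (refl , refl)) = inj₁ refl

  private
    apex∈tri : ∀ c i {s b} → bit i s ≡ b → (i , at c b) ∈ᵇ (c , tri s)
    apex∈tri c i {s} refl = ∈-tri⁺ c i s

  -- Every path of class `c` starts at `⟦ c ⟧`, so the first block of a rail contains the octahedron
  -- edge from there to its apex and shares it with the face. Its third point, at position 1, is not
  -- on the face.
  rail-start~tri : ∀ {c} i b {s} → c < m → bit i s ≡ false → bit (next i) s ≡ b → (c , rail i b 0) ~ (c , tri s)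
  rail-start~tri {c} i b {s} c< eq eq′ =
    ~-intro {c , rail i b 0} {c , tri s} {i , at c false} {next i , at c b} {i , path i b c 1} (c< , z≤n)
      (next≢ i ∘ sym ∘ cong proj₁) (inj₁ (cong (i ,_) (sym (Z.start i b c)))) (apex∈tri c i eq)
      (inj₂ (inj₂ refl)) (apex∈tri c (next i) eq′) (inj₂ (inj₁ refl))
      λ w∈ → path-≢ i b c (s≤s z≤n) (s≤s (s≤s z≤n)) (λ ())
        (trans (Z.start i b c) (sym (trans (∈-tri⁻ c i s w∈) (cong (at c) eq))))

  rail-end~tri : ∀ {c} i b {s} → c < m → bit i s ≡ true → bit (next i) s ≡ b → (c , rail i b t) ~ (c , tri s)
  rail-end~tri {c} i b {s} c< eq eq′ =
    ~-intro {c , rail i b t} {c , tri s} {i , at c true} {next i , at c b} {i , path i b c t} (c< , ≤-refl)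
      (next≢ i ∘ sym ∘ cong proj₁) (inj₂ (inj₁ (cong (i ,_) (sym (Z.end i b c))))) (apex∈tri c i eq)
      (inj₂ (inj₂ refl)) (apex∈tri c (next i) eq′) (inj₁ refl)
      λ w∈ → path-≢ i b c (≤t⇒<N ≤-refl) (n<1+n (suc t)) (<⇒≢ (n<1+n t))
        (trans (trans (∈-tri⁻ c i s w∈) (cong (at c) eq)) (sym (Z.end i b c)))

  -- Pairs of points and the blocks through them

  TwoBlocks : Point → Point → Set
  TwoBlocks u v = ∃₂ λ l l′ → l ≢ l′ × (Valid l × u ∈ᵇ l × v ∈ᵇ l) × (Valid l′ × u ∈ᵇ l′ × v ∈ᵇ l′) ×
    (∀ w → Valid w → u ∈ᵇ w → v ∈ᵇ w → w ≡ l ⊎ w ≡ l′)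

  TwoBlocks-sym : ∀ {u v} → TwoBlocks u v → TwoBlocks v u
  TwoBlocks-sym (l , l′ , l≢l′ , (v , u∈ , v∈) , (v′ , u∈′ , v∈′) , only) =
    l , l′ , l≢l′ , (v , v∈ , u∈) , (v′ , v∈′ , u∈′) , λ w vw v∈w u∈w → only w vw u∈w v∈w

  -- Each of the two path families on the level contains the edge exactly once. Faces, and rails
  -- having their apex on the level, meet it in a single point.
  two-blocks-same : ∀ i {x y} → x ≢ y → TwoBlocks (i , x) (i , y)
  two-blocks-same i {x} {y} x≢y
    with c , k , c< , k≤ , e ← Z.edge-exists i false x y x≢y
       | c′ , k′ , c′< , k′≤ , e′ ← Z.edge-exists i true x y x≢y =
    (c , rail i false k) , (c′ , rail i true k′) , (λ ()) ,
    ((c< , k≤) , ends e) , ((c′< , k′≤) , ends e′) , only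
    where
    ends : ∀ {c b k} → Edge (path i b) c k x y → (i , x) ∈ᵇ (c , rail i b k) × (i , y) ∈ᵇ (c , rail i b k)
    ends (inj₁ (refl , refl)) = inj₁ refl , inj₂ (inj₁ refl)
    ends (inj₂ (refl , refl)) = inj₂ (inj₁ refl) , inj₁ refl
    here-is : ∀ {d b j} → d < m → j ≤ t → Edge (path i b) d j x y →
      (d , rail i b j) ≡ (c , rail i false k) ⊎ (d , rail i b j) ≡ (c′ , rail i true k′)
    here-is {b = false} d< j≤ f with refl , refl ← Z.edge-unique i false d< c< j≤ k≤ f e = inj₁ refl
    here-is {b = true}  d< j≤ f with refl , refl ← Z.edge-unique i true d< c′< j≤ k′≤ f e′ = inj₂ refl
    only : ∀ w → Valid w → (i , x) ∈ᵇ w → (i , y) ∈ᵇ w → w ≡ (c , rail i false k) ⊎ w ≡ (c′ , rail i true k′)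
    only (d , tri s) _ x∈ y∈ = contradiction (trans (∈-tri⁻ d i s x∈) (sym (∈-tri⁻ d i s y∈))) x≢y
    only (d , rail i′ b j) (d< , j≤) x∈ y∈ with ∈-rail⁻ x∈ | ∈-rail⁻ y∈
    ... | inj₁ (refl , _) | inj₂ (eq , _) = contradiction (sym eq) (next≢ i)
    ... | inj₂ (eq , _) | inj₁ (refl , _) = contradiction (sym eq) (next≢ i)
    ... | inj₂ (_ , eq) | inj₂ (_ , eq′) = contradiction (trans (sym eq) eq′) x≢y
    ... | inj₁ (refl , inj₁ eq) | inj₁ (_ , inj₁ eq′) = contradiction (trans (sym eq) eq′) x≢y
    ... | inj₁ (refl , inj₂ eq) | inj₁ (_ , inj₂ eq′) = contradiction (trans (sym eq) eq′) x≢y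
    ... | inj₁ (refl , inj₁ eq) | inj₁ (_ , inj₂ eq′) = here-is d< j≤ (inj₁ (eq , eq′))
    ... | inj₁ (refl , inj₂ eq) | inj₁ (_ , inj₁ eq′) = here-is d< j≤ (inj₂ (eq′ , eq))

  -- The position j on the path meets the two path edges at j, except that at either end one edge is
  -- replaced by an octahedron face.
  data Through (i : Fin 3) (b : Bool) (c j : ℕ) : Label → Set where
    incoming : ∀ {k} → j ≡ suc k → k ≤ t → Through i b c j (c , rail i b k)
    outgoing : j ≤ t → Through i b c j (c , rail i b j)
    initial  : j ≡ 0 → Through i b c j (c , tri (face i false b))
    final    : j ≡ suc t → Through i b c j (c , tri (face i true b))

  through⁺ : ∀ {i b c j l} → c < m → Through i b c j l →
    Valid l × (i , path i b c j) ∈ᵇ l × (next i , at c b) ∈ᵇ l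
  through⁺ c< (incoming refl k≤) = (c< , k≤) , inj₂ (inj₁ refl) , inj₂ (inj₂ refl)
  through⁺ c< (outgoing j≤)      = (c< , j≤) , inj₁ refl , inj₂ (inj₂ refl)
  through⁺ {i} {b} {c} c< (initial refl) = c< ,
    subst (λ x → (i , x) ∈ᵇ (c , tri (face i false b))) (sym (Z.start i b c)) (apex∈tri c i (bit-face i false b)) ,
    apex∈tri c (next i) (bit-next-face i false b)
  through⁺ {i} {b} {c} c< (final refl) = c< ,
    subst (λ x → (i , x) ∈ᵇ (c , tri (face i true b))) (sym (Z.end i b c)) (apex∈tri c i (bit-face i true b)) ,
    apex∈tri c (next i) (bit-next-face i true b)

  -- The apex identifies class and bit, and injectivity of the path identifies the position. A face
  -- through both points forces the position to be an end of the path.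
  through⁻ : ∀ {i b c j} → c < m → j < N → ∀ w → Valid w →
    (i , path i b c j) ∈ᵇ w → (next i , at c b) ∈ᵇ w → Through i b c j w
  through⁻ {i} {b} {c} {j} c< j< (d , rail i′ b′ k) (d< , k≤) x∈ y∈ with ∈-rail⁻ x∈ | ∈-rail⁻ y∈
  ... | inj₁ (refl , _) | inj₁ (eq , _) = contradiction eq (next≢ i)
  ... | inj₂ (refl , _) | inj₁ (eq , _) = contradiction eq (next²≢ i′)
  ... | inj₂ (eq , _) | inj₂ (eq′ , _) = contradiction (trans eq′ (sym eq)) (next≢ i)
  ... | inj₁ (refl , x≡) | inj₂ (_ , y≡) with refl , refl ← at-injective b′ b d< c< y≡ with x≡
  ...   | inj₁ eq with refl ← Z.injective i b c (≤t⇒<N k≤) j< eq = outgoing k≤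
  ...   | inj₂ eq with refl ← Z.injective i b c (s≤s (s≤s k≤)) j< eq = incoming refl k≤
  through⁻ {i} {b} {c} {j} c< j< (d , tri s) d< x∈ y∈
    with refl , refl ← at-injective b (bit (next i) s) c< d< (∈-tri⁻ d (next i) s y∈)
    with bit i s in eq | ∈-tri⁻ d i s x∈
  ... | false | x≡ with refl ← Z.injective i b c j< (s≤s z≤n) (trans x≡ (sym (Z.start i b c))) =
    subst (λ s′ → Through i b c 0 (c , tri s′))
      (trans (cong (λ β → face i β b) (sym eq)) (face-bit i s)) (initial refl)
  ... | true  | x≡ with refl ← Z.injective i b c j< (n<1+n (suc t)) (trans x≡ (sym (Z.end i b c))) =
    subst (λ s′ → Through i b c (suc t) (c , tri s′))
      (trans (cong (λ β → face i β b) (sym eq)) (face-bit i s)) (final refl)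

  two-through : ∀ i b c j → j < N → ∃₂ λ l l′ → l ≢ l′ × Through i b c j l × Through i b c j l′ ×
    (∀ {w} → Through i b c j w → w ≡ l ⊎ w ≡ l′)
  two-through i b c zero _ = _ , _ , (λ ()) , outgoing z≤n , initial refl , λ where
    (outgoing _) → inj₁ refl
    (initial _)  → inj₂ refl
  two-through i b c (suc j) j< with j ≟ t
  ... | yes refl = _ , _ , (λ ()) , incoming refl ≤-refl , final refl , λ where
    (incoming refl _) → inj₁ refl
    (outgoing t<)     → contradiction t< 1+n≰n
    (final _)         → inj₂ refl
  ... | no j≢t = _ , _ , (λ ()) , incoming refl (<N⇒≤t j<) , outgoing (≤∧≢⇒< (<N⇒≤t j<) j≢t) , λ where
    (incoming refl _) → inj₁ refl
    (outgoing _)      → inj₂ refl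
    (final refl)      → contradiction refl j≢t

  -- The point on the next level is `at c b` for one class and bit, and the corresponding path
  -- visits every point of level `i`; its position there reduces the count to `two-through`.
  two-blocks-above : ∀ i x y → TwoBlocks (i , x) (next i , y)
  two-blocks-above i x y with c , b , c< , refl ← at-surjective y with j , j< , refl ← Z.surjective i b c x
    with l , l′ , l≢l′ , th , th′ , only ← two-through i b c j j< =
    l , l′ , l≢l′ , through⁺ c< th , through⁺ c< th′ , λ w vw x∈ y∈ → only (through⁻ c< j< w vw x∈ y∈)

  two-blocks : ∀ u v → u ≢ v → TwoBlocks u v
  two-blocks (i , x) (j , y) u≢v with levels i j
  ... | same  = two-blocks-same i (u≢v ∘ cong (i ,_))
  ... | above = two-blocks-above i x y
  ... | below = TwoBlocks-sym (two-blocks-above j y x)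

  balanced : ∀ {ls} → (∀ {l} → Valid l → l ∈ˡ ls) → (∀ {l} → l ∈ˡ ls → Valid l) →
    ∀ x y → x ≢ y → ExactlyTwo (λ l → x ∈ block l × y ∈ block l) ls
  balanced complete sound x y x≢y
    with two-blocks (decode x) (decode y) (λ eq →
      x≢y (trans (sym (encode-decode x)) (trans (cong encode eq) (encode-decode y))))
  ... | l , l′ , l≢l′ , (vl , x∈ , y∈) , (vl′ , x∈′ , y∈′) , only =
    l , l′ , l≢l′ , (complete vl , into l x∈ , into l y∈) , (complete vl′ , into l′ x∈′ , into l′ y∈′) ,
    λ {w} w∈ (x∈w , y∈w) → only w (sound w∈) (from w x∈w) (from w y∈w)
    where
    into : ∀ {x} l → decode x ∈ᵇ l → x ∈ block l
    into {x} l x∈ = subst (_∈ block l) (encode-decode x) (∈-block⁺ l x∈)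
    from : ∀ {x} l → x ∈ block l → decode x ∈ᵇ l
    from {x} l x∈ = ∈-block⁻ l (subst (_∈ block l) (sym (encode-decode x)) x∈)

-- The Hamilton cycle

Unique-resp-↭ : ∀ {A : Set} {xs ys : List A} → xs ↭ ys → Unique xs → Unique ys
Unique-resp-↭ {A} = Permutationₛ.Unique-resp-↭ (setoid A) ∘ ↭⇒↭ₛ

-- Descending positions and assembly by classes

down : ℕ → List ℕ
down zero    = [ zero ]
down (suc a) = suc a ∷ down a

desc : ℕ → ℕ → List ℕ
desc a zero    = [ a ]
desc a (suc n) = suc n + a ∷ desc a n

desc-++-down : ∀ a n → desc (suc a) n ++ down a ≡ down (n + suc a)
desc-++-down a zero    = refl
desc-++-down a (suc n) = cong (suc n + suc a ∷_) (desc-++-down a n)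

∈-down⁺ : ∀ {k a} → k ≤ a → k ∈ˡ down a
∈-down⁺ {zero} {zero} z≤n = here refl
∈-down⁺ {k} {suc a} k≤ with k ≟ suc a
... | yes refl = here refl
... | no k≢    = there (∈-down⁺ (s≤s⁻¹ (≤∧≢⇒< k≤ k≢)))

∈-down⁻ : ∀ {k} a → k ∈ˡ down a → k ≤ a
∈-down⁻ zero    (here refl) = z≤n
∈-down⁻ (suc a) (here refl) = ≤-refl
∈-down⁻ (suc a) (there k∈)  = m≤n⇒m≤1+n (∈-down⁻ a k∈)

down-unique : ∀ a → Unique (down a)
down-unique zero    = [] ∷ []
down-unique (suc a) = All.tabulate (λ k∈ eq → <⇒≢ (s≤s (∈-down⁻ a k∈)) (sym eq)) ∷ down-unique a

bools : List Bool
bools = false ∷ true ∷ []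

∈-bools : ∀ b → b ∈ˡ bools
∈-bools false = here refl
∈-bools true  = there (here refl)

bools-unique : Unique bools
bools-unique = ((λ ()) ∷ []) ∷ [] ∷ []

assemble : ℕ → List (List Local) → List Label
assemble c []       = []
assemble c (s ∷ ss) = map (c ,_) s ++ assemble (suc c) ss

module _ {K : List Local} where

  -- As every class uses a rearrangement of the same list `K`, membership splits into a range check
  -- on the class and membership in `K`.
  ∈-assemble⁻ : ∀ {c ss d l} → All (_↭ K) ss → (d , l) ∈ˡ assemble c ss → c ≤ d × d < c + length ss × l ∈ˡ K
  ∈-assemble⁻ {c} {s ∷ ss} (p ∷ ps) l∈ with ∈-++⁻ (map (c ,_) s) l∈
  ... | inj₁ l∈s with _ , l∈s′ , refl ← ∈-map⁻ (c ,_) l∈s =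
    ≤-refl , ≤-trans (s≤s (m≤m+n c _)) (≤-reflexive (sym (+-suc c _))) , ∈-resp-↭ p l∈s′
  ... | inj₂ l∈ss with c< , d< , l∈K ← ∈-assemble⁻ ps l∈ss =
    <⇒≤ c< , ≤-trans d< (≤-reflexive (sym (+-suc c _))) , l∈K

  ∈-assemble⁺ : ∀ {c ss d l} → All (_↭ K) ss → c ≤ d → d < c + length ss → l ∈ˡ K → (d , l) ∈ˡ assemble c ss
  ∈-assemble⁺ {c} {[]} _ c≤ d< _ = contradiction (subst (_ <_) (+-identityʳ c) d<) (≤⇒≯ c≤)
  ∈-assemble⁺ {c} {s ∷ ss} {d} (p ∷ ps) c≤ d< l∈K with c ≟ d
  ... | yes refl = ∈-++⁺ˡ (∈-map⁺ (c ,_) (∈-resp-↭ (↭-sym p) l∈K))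
  ... | no c≢d   = ∈-++⁺ʳ (map (c ,_) s) (∈-assemble⁺ ps (≤∧≢⇒< c≤ c≢d) (subst (d <_) (+-suc c _) d<) l∈K)

  assemble-unique : ∀ {c ss} → Unique K → All (_↭ K) ss → Unique (assemble c ss)
  assemble-unique K! [] = []
  assemble-unique {c} {s ∷ ss} K! (p ∷ ps) = Unique.++⁺
    (Unique.map⁺ (λ where refl → refl) (Unique-resp-↭ (↭-sym p) K!)) (assemble-unique K! ps) disjoint
    where
    disjoint : ∀ {l} → ¬ (l ∈ˡ map (c ,_) s × l ∈ˡ assemble (suc c) ss)
    disjoint (l∈s , l∈ss) with _ , _ , refl ← ∈-map⁻ (c ,_) l∈s =
      contradiction (proj₁ (∈-assemble⁻ {suc c} {ss} ps l∈ss)) 1+n≰n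

module HamiltonCycle (h : ℕ) where
  open Zigzags h
  open Blocks h

  rails : Fin 3 → Bool → List Local
  rails i b = map (rail i b) (down t)

  faces : List (Bool × Bool)
  faces = cartesianProduct bools bools

  railings : List (Fin 3 × Bool)
  railings = cartesianProduct (allFin 3) bools

  -- The reference list for one class: the part of the Hamilton cycle inside any class is a
  -- permutation of it.
  locals : List Local
  locals = map tri faces ++ cartesianProductWith (uncurry rail) railings (down t)

  locals-unique : Unique locals
  locals-unique = Unique.++⁺
    (Unique.map⁺ {f = tri} (λ where refl → refl) (Unique.cartesianProduct⁺ bools-unique bools-unique))
    (Unique.cartesianProductWith⁺ (uncurry rail) (λ where refl → refl , refl)
      (Unique.cartesianProduct⁺ (Unique.allFin⁺ 3) bools-unique) (down-unique t))
    λ (l∈ , l∈′) → disjoint (∈-map⁻ tri l∈) (∈-cartesianProductWith⁻ (uncurry rail) railings (down t) l∈′)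
    where
    disjoint : ∀ {l} → ∃ (λ s → s ∈ˡ faces × l ≡ tri s) →
      ¬ ∃₂ (λ ib k → ib ∈ˡ railings × k ∈ˡ down t × l ≡ uncurry rail ib k)
    disjoint (_ , _ , refl) (_ , _ , _ , _ , ())

  ∈-locals⁺ : ∀ {c} l → Valid (c , l) → l ∈ˡ locals
  ∈-locals⁺ (tri (b , b′)) _        = ∈-++⁺ˡ (∈-map⁺ tri (∈-cartesianProduct⁺ (∈-bools b) (∈-bools b′)))
  ∈-locals⁺ (rail i b k)   (_ , k≤) = ∈-++⁺ʳ (map tri faces)
    (∈-cartesianProductWith⁺ (uncurry rail) (∈-cartesianProduct⁺ (∈-allFin i) (∈-bools b)) (∈-down⁺ k≤))

  ∈-locals⁻ : ∀ {c} l → c < m → l ∈ˡ locals → Valid (c , l)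
  ∈-locals⁻ (tri _)      c< _  = c<
  ∈-locals⁻ (rail i b k) c< l∈ with ∈-++⁻ (map tri faces) l∈
  ... | inj₁ l∈ with _ , _ , () ← ∈-map⁻ tri l∈
  ... | inj₂ l∈ with _ , _ , _ , k∈ , refl ← ∈-cartesianProductWith⁻ (uncurry rail) railings (down t) l∈ =
    c< , ∈-down⁻ t k∈

  -- The ladder has an odd number of rungs, so crossing at every rung leads to the opposite corner.
  snake : ℕ → List Local
  snake zero    = rail 2F false 0 ∷ rail 2F true 0 ∷ []
  snake (suc r) = rail 2F false (dbl (suc r)) ∷ rail 2F true (dbl (suc r)) ∷
                  rail 2F true (suc (dbl r)) ∷ rail 2F false (suc (dbl r)) ∷ snake r

  -- The faces dictate the corners. For `false`, both faces have bit 0 on level 1, so the ladder is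
  -- left at the end where it was entered, on the other rail. For `true`, their bits on level 2 are
  -- 1 and 0, so it is crossed to the diagonally opposite corner.
  turn : Bool → List Local
  turn false = reverse (rails 1F false) ++ rails 1F true
  turn true  = snake (suc h)

  -- The cycle of a level-0 rail, opened between the positions a and a + 1; n = t − (a + 1).
  loop : Bool → ℕ → ℕ → List Local
  loop b a n = map (rail 0F b) (down a) ++ tri (false , b) ∷ turn b ++ tri (true , b) ∷ map (rail 0F b) (desc (suc a) n)

  private
    module Solver = CommutativeMonoidSolver (++-commutativeMonoid {A = Local})
    open Solver using (solve; _⊕_; _⊜_)

  snake-↭ : ∀ r → snake r ↭ map (rail 2F false) (down (dbl r)) ++ map (rail 2F true) (down (dbl r))
  snake-↭ zero    = ↭-refl
  snake-↭ (suc r) = ↭-trans (++⁺ˡ (a ∷ b ∷ b′ ∷ a′ ∷ []) (snake-↭ r))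
    (solve 6 (λ a b b′ a′ xs ys → a ⊕ (b ⊕ (b′ ⊕ (a′ ⊕ (xs ⊕ ys)))) ⊜ (a ⊕ (a′ ⊕ xs)) ⊕ (b ⊕ (b′ ⊕ ys))) ↭-refl
      [ a ] [ b ] [ b′ ] [ a′ ] (map (rail 2F false) (down (dbl r))) (map (rail 2F true) (down (dbl r))))
    where
    a  = rail 2F false (dbl (suc r))
    a′ = rail 2F false (suc (dbl r))
    b  = rail 2F true (dbl (suc r))
    b′ = rail 2F true (suc (dbl r))

  turned : Bool → Fin 3
  turned false = 1F
  turned true  = 2F

  turn-↭ : ∀ b → turn b ↭ rails (turned b) false ++ rails (turned b) true
  turn-↭ false = ++⁺ (↭-reverse (rails 1F false)) ↭-refl
  turn-↭ true  = subst (λ z → snake (suc h) ↭ map (rail 2F false) (down z) ++ map (rail 2F true) (down z))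
    (sym t≡dbl) (snake-↭ (suc h))

  -- The two pieces of the opened rail, put back in the other order, form the full descending rail.
  loop-↭ : ∀ b {a n} → n + suc a ≡ t → loop b a n ↭
    tri (false , b) ∷ tri (true , b) ∷ rails 0F b ++ rails (turned b) false ++ rails (turned b) true
  loop-↭ b {a} {n} eq = begin
    loop b a n
      ↭⟨ solve 5 (λ xs y us z vs → xs ⊕ (y ⊕ (us ⊕ (z ⊕ vs))) ⊜ y ⊕ (z ⊕ ((vs ⊕ xs) ⊕ us))) ↭-refl
           (map (rail 0F b) (down a)) [ _ ] (turn b) [ _ ] (map (rail 0F b) (desc (suc a) n)) ⟩
    tri (false , b) ∷ tri (true , b) ∷ (map (rail 0F b) (desc (suc a) n) ++ map (rail 0F b) (down a)) ++ turn b
      ≡⟨ cong (λ z → tri (false , b) ∷ tri (true , b) ∷ z ++ turn b)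
           (trans (sym (map-++ (rail 0F b) (desc (suc a) n) (down a)))
             (cong (map (rail 0F b)) (trans (desc-++-down a n) (cong down eq)))) ⟩
    tri (false , b) ∷ tri (true , b) ∷ rails 0F b ++ turn b
      ↭⟨ ++⁺ˡ (tri (false , b) ∷ tri (true , b) ∷ rails 0F b) (turn-↭ b) ⟩
    tri (false , b) ∷ tri (true , b) ∷ rails 0F b ++ rails (turned b) false ++ rails (turned b) true ∎
    where open PermutationReasoning

  loops-↭ : ∀ {xs ys a n a′ n′} → n + suc a ≡ t → n′ + suc a′ ≡ t → xs ↭ loop false a n → ys ↭ loop true a′ n′ →
    xs ++ ys ↭ locals
  loops-↭ eq eq′ p p′ = ↭-trans (++⁺ (↭-trans p (loop-↭ false eq)) (↭-trans p′ (loop-↭ true eq′)))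
    (solve 10 (λ a b r₀ r₁ r₁′ c d r₀′ r₂ r₂′ →
        (a ⊕ (b ⊕ (r₀ ⊕ (r₁ ⊕ r₁′)))) ⊕ (c ⊕ (d ⊕ (r₀′ ⊕ (r₂ ⊕ r₂′)))) ⊜
        a ⊕ (c ⊕ (b ⊕ (d ⊕ (r₀ ⊕ (r₀′ ⊕ (r₁ ⊕ (r₁′ ⊕ (r₂ ⊕ (r₂′ ⊕ Solver.id)))))))))) ↭-refl
      [ _ ] [ _ ] (rails 0F false) (rails 1F false) (rails 1F true)
      [ _ ] [ _ ] (rails 0F true) (rails 2F false) (rails 2F true))

  -- Walks within and between classes

  module _ {c : ℕ} (c< : c < m) where

    _~ᶜ_ : Local → Local → Set
    _~ᶜ_ = _~_ on (c ,_)

    down-walk : ∀ i b {a} → a ≤ t → Walk _~ᶜ_ (rail i b a) (rail i b 0) (map (rail i b) (down a))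
    down-walk i b {zero}  _  = stop
    down-walk i b {suc a} a< = step (~-sym (rail~rail c< a<)) (down-walk i b (<⇒≤ a<))

    desc-walk : ∀ i b {a} n → n + a ≤ t → Walk _~ᶜ_ (rail i b (n + a)) (rail i b a) (map (rail i b) (desc a n))
    desc-walk i b zero    _  = stop
    desc-walk i b {a} (suc n) n< = step (~-sym (rail~rail c< n<)) (desc-walk i b n (<⇒≤ n<))

    ladder-rung : ∀ i b b′ {k} → b ≢ b′ → k ≤ t → rail (fsuc i) b k ~ᶜ rail (fsuc i) b′ k
    ladder-rung i b b′ b≢b′ k≤ = rung {i = fsuc i} {b} {b′} c< c< k≤ b≢b′ (inj₁ (refl , refl))

    snake-walk : ∀ r → dbl r ≤ t → Walk _~ᶜ_ (rail 2F false (dbl r)) (rail 2F true 0) (snake r)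
    snake-walk zero    r≤ = step (ladder-rung 1F false true (λ ()) r≤) stop
    snake-walk (suc r) r≤ =
      step (ladder-rung 1F false true (λ ()) r≤)
      (step (~-sym (rail~rail c< r≤))
      (step (ladder-rung 1F true false (λ ()) (<⇒≤ r≤))
      (step (~-sym (rail~rail c< (<⇒≤ r≤))) (snake-walk r (<⇒≤ (<⇒≤ r≤))))))

    loop-walk : ∀ b {a n} → n + suc a ≡ t → Walk _~ᶜ_ (rail 0F b a) (rail 0F b (suc a)) (loop b a n)
    loop-walk b {a} {n} eq =
      walk-++ (down-walk 0F b (≤-trans (n≤1+n a) (m+n≤o⇒n≤o n (≤-reflexive eq)))) (rail-start~tri 0F b c< refl refl)
        (turn-walk b (subst (λ z → Walk _~ᶜ_ (rail 0F b z) (rail 0F b (suc a)) (map (rail 0F b) (desc (suc a) n)))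
          eq (desc-walk 0F b n (≤-reflexive eq))))
      where
      turn-walk : ∀ b {l ls} → Walk _~ᶜ_ (rail 0F b t) l ls →
        Walk _~ᶜ_ (tri (false , b)) l (tri (false , b) ∷ turn b ++ tri (true , b) ∷ ls)
      -- Both turns leave through the face `tri (true , b)`, which meets the last block of the
      -- level-0 rail.
      turn-walk b w with step (~-sym (rail-end~tri 0F b c< refl refl)) w
      turn-walk false w | w′ = step (~-sym (rail-start~tri 1F false c< refl refl))
        (walk-++ (walk-++ (walk-reverse ~-sym (down-walk 1F false ≤-refl))
                   (ladder-rung 0F false true (λ ()) ≤-refl) (down-walk 1F true ≤-refl))
          (rail-start~tri 1F true c< refl refl) w′)
      turn-walk true w | w′ = step (~-sym (rail-end~tri 2F false c< refl refl))
        (walk-++ (subst (λ z → Walk _~ᶜ_ (rail 2F false z) (rail 2F true 0) (snake (suc h)))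
            (sym t≡dbl) (snake-walk (suc h) (≤-reflexive (sym t≡dbl))))
          (rail-start~tri 2F true c< refl refl) w′)

    odd-rung : ∀ i → suc i < m → rail 0F true (suc (dbl i)) ~ᶜ rail 0F false (suc (dbl i))
    odd-rung i i< = let e , e′ = rung-odd c i i< in
      rung {i = 0F} {true} {false} c< c< (<⇒≤ (s≤s⁻¹ (s≤s⁻¹ (dbl<N i<)))) (λ ()) (inj₂ (sym e′ , sym e))

  even-rung : ∀ {c} i → suc c < m → i < m → (c , rail 0F true (dbl i)) ~ (suc c , rail 0F false (dbl i))
  even-rung {c} i c< i< = let e , e′ = rung-even c i i< in
    rung {i = 0F} {true} {false} (<⇒≤ c<) c< (s≤s⁻¹ (s≤s⁻¹ (dbl<N i<))) (λ ()) (inj₂ (sym e′ , sym e))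

  wrap-rung : (suc h , rail 0F true t) ~ (0 , rail 0F false 0)
  wrap-rung = rung {i = 0F} {true} {false} (n<1+n _) (s≤s z≤n) ≤-refl (λ ())
    (inj₁ (sym (proj₁ rung-wrap) , sym (proj₂ rung-wrap)))

  -- A ring of rungs through the level-0 rails leaves class c + 1 two positions beyond where it entered
  -- it.  Passing the last class reverses positions (k becomes t − k), so the drift over the m classes
  -- must add up to t = 2m − 2 and not to 2m; hence class 0 has no drift and its second loop is reversed.
  segment₀ : List Local
  segment₀ = loop false 0 (suc (dbl h)) ++ reverse (loop true 0 (suc (dbl h)))

  -- This is the part in class c + 1, with r = h - c classes still to come. It enters at 2c, leaves
  -- the first loop at 2c + 1, crosses an odd rung and leaves the second loop at 2c + 2. The last
  -- arguments are t - (2c + 1) and t - (2c + 2).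
  segment : ℕ → ℕ → List Local
  segment c r = loop false (dbl c) (suc (dbl r)) ++ loop true (suc (dbl c)) (dbl r)

  -- Split in two so that the first segment is visible without a case distinction on `r`.
  segments more : ℕ → ℕ → List (List Local)
  segments c r = segment c r ∷ more c r
  more c zero    = []
  more c (suc r) = segments (suc c) r

  hamilton : List Label
  hamilton = assemble 0 (segment₀ ∷ segments 0 h)

  dbl-+ : ∀ r c → dbl r + dbl c ≡ dbl (r + c)
  dbl-+ zero    c = refl
  dbl-+ (suc r) c = cong (λ z → suc (suc z)) (dbl-+ r c)

  cut-false : ∀ {c r} → r + c ≡ h → suc (dbl r) + suc (dbl c) ≡ t
  cut-false {c} {r} refl = trans (cong suc (trans (+-suc (dbl r) (dbl c)) (cong suc (dbl-+ r c)))) (sym t≡dbl)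

  cut-true : ∀ {c r} → r + c ≡ h → dbl r + suc (suc (dbl c)) ≡ t
  cut-true {c} {r} eq = trans (+-suc (dbl r) (suc (dbl c))) (cut-false {c} {r} eq)

  segments-↭ : ∀ c r → r + c ≡ h → All (_↭ locals) (segments c r)
  segments-↭ c r eq =
    loops-↭ {n = suc (dbl r)} {n′ = dbl r} (cut-false {c} eq) (cut-true {c} eq) ↭-refl ↭-refl ∷ rest r eq
    where
    rest : ∀ r → r + c ≡ h → All (_↭ locals) (more c r)
    rest zero    _  = []
    rest (suc r) eq = segments-↭ (suc c) r (trans (+-suc r c) eq)

  length-segments : ∀ c r → length (segments c r) ≡ suc r
  length-segments c zero    = refl
  length-segments c (suc r) = cong suc (length-segments (suc c) r)

  all-↭ : All (_↭ locals) (segment₀ ∷ segments 0 h)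
  all-↭ = loops-↭ {n = suc (dbl h)} {n′ = suc (dbl h)} (cut-false (+-identityʳ h)) (cut-false (+-identityʳ h)) ↭-refl
      (↭-reverse (loop true 0 (suc (dbl h))))
    ∷ segments-↭ 0 h (+-identityʳ h)

  segment-walk : ∀ {c r} → r + c ≡ h → Walk _~_ (suc c , rail 0F false (dbl c)) (suc c , rail 0F true (dbl (suc c)))
    (map (suc c ,_) (segment c r))
  segment-walk {c} {r} eq = walk-map (suc c ,_)
    (walk-++ (loop-walk c< false {n = suc (dbl r)} (cut-false {c} eq))
      (~-sym (odd-rung c< c c<))
      (loop-walk c< true {n = dbl r} (cut-true {c} eq)))
    where
    c< : suc c < m
    c< = s≤s (s≤s (m+n≤o⇒n≤o r (≤-reflexive eq)))

  segments-walk : ∀ c r → r + c ≡ h → Walk _~_ (suc c , rail 0F false (dbl c)) (suc h , rail 0F true t)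
    (assemble (suc c) (segments c r))
  -- In the last class the exit position 2(c + 1) is `t`, where `wrap-rung` closes the ring.
  segments-walk c zero    refl = subst₂ (Walk _~_ _)
    (cong (λ z → suc h , rail 0F true z) (sym t≡dbl)) (sym (++-identityʳ _)) (segment-walk {c} {zero} refl)
  segments-walk c (suc r) eq = walk-++ (segment-walk {c} {suc r} eq)
    (even-rung (suc c) (s≤s (s≤s (≤-trans (s≤s (m≤n+m c r)) (≤-reflexive eq))))
      (s≤s (s≤s (m+n≤o⇒n≤o (suc r) (≤-reflexive eq)))))
    (segments-walk (suc c) r (trans (+-suc r c) eq))

  hamilton-walk : Walk _~_ (0 , rail 0F false 0) (suc h , rail 0F true t) hamilton
  hamilton-walk = walk-++
    (walk-map (0 ,_) (walk-++ (loop-walk 0< false {n = suc (dbl h)} eq)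
      (~-sym (odd-rung 0< 0 (s≤s (s≤s z≤n))))
      (walk-reverse ~-sym (loop-walk 0< true {n = suc (dbl h)} eq))))
    (even-rung 0 (s≤s (s≤s z≤n)) 0<)
    (segments-walk 0 h (+-identityʳ h))
    where
    0< : 0 < m
    0< = s≤s z≤n
    eq : suc (dbl h) + 1 ≡ t
    eq = cut-false (+-identityʳ h)

  sound : ∀ {l} → l ∈ˡ hamilton → Valid l
  sound {c , l} l∈ with _ , c< , l∈K ← ∈-assemble⁻ all-↭ l∈ =
    ∈-locals⁻ l (subst (c <_) (cong suc (length-segments 0 h)) c<) l∈K

  complete : ∀ {l} → Valid l → l ∈ˡ hamilton
  complete {c , l} v = ∈-assemble⁺ all-↭ z≤n
    (subst (c <_) (cong suc (sym (length-segments 0 h))) (class l v)) (∈-locals⁺ {c} l v)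
    where
    class : ∀ l → Valid (c , l) → c < m
    class (tri _)      c<       = c<
    class (rail _ _ _) (c< , _) = c<

  3≤length : 3 ≤ length hamilton
  -- The first two labels appear by computation; `xs` is the rest of class 0, and class 1 supplies a
  -- third.
  3≤length = s≤s (s≤s (subst (1 ≤_) (sym (length-++ xs)) (m≤n⇒m≤o+n (length xs) (s≤s z≤n))))
    where
    xs : List Label
    xs = map (0 ,_) ((turn false ++ tri (true , false) ∷ map (rail 0F false) (desc 1 (suc (dbl h))))
      ++ reverse (loop true 0 (suc (dbl h))))

  hamiltonian : Σ[ T ∈ TTS (3 * N) ] Hamiltonian (2-BIG T)
  hamiltonian = closed-walk⇒Hamiltonian block hamilton-walk wrap-rung 3≤length (assemble-unique locals-unique all-↭)
    (All.tabulate λ {l} → ∣block∣≡3 l ∘ sound) (balanced complete sound)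

theorem8p1 : ∀ (v : ℕ) → 7 ≤ v → Odd v →
    (Σ[ T ∈ TTS v ] Hamiltonian (2-BIG T)) →
    Σ[ T ∈ TTS (3 * v + 3) ] Hamiltonian (2-BIG T)
theorem8p1 _ (s≤s ()) (zero , refl) _
theorem8p1 _ _ (suc h , refl) _ =
  -- For v = 2(h + 1) + 1 the number v + 1 is `N`, so 3v + 3 = 3N.
  subst (λ n → Σ[ T ∈ TTS n ] Hamiltonian (2-BIG T))
    (solveℕ 1 (λ h → con 3 :* ((con 2 :+ h) :+ (con 2 :+ h)) :=
                     con 3 :* (con 2 :* (con 1 :+ h) :+ con 1) :+ con 3) refl h)
    (HamiltonCycle.hamiltonian h)
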